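{- There is a constant $c$ such that, as $n\to\infty$, the fraction of Boolean $n\times n$ matrices $A$ for which the size of a smallest cancellation-free linear circuit computing $A$ is at most $c$ times the size of a smallest linear circuit computing $A$ tends to $1$. That is, for almost every matrix the cancellation ratio is bounded by a constant.
   Context: A linear circuit over $\mathbb{F}_2$ with inputs $x_1,\ldots,x_n$ is a directed acyclic graph whose in-degree-0 nodes are the inputs and whose other nodes (gates) have in-degree 2 and compute the XOR of their two children; $n$ nodes are designated as outputs $y_1,\ldots,y_n$, and the circuit computes $A$ if $\mathbf{y}=A\mathbf{x}$ for all $\mathbf{x}\in\mathbb{F}_2^n$. The size is the number of gates. The value vector $\kappa(u)\in\mathbb{F}_2^n$ of a node $u$ has $\kappa(u)_i=1$ iff $x_i$ occurs in the parity computed at $u$. A linear circuit is cancellation-free if whenever there is a directed path from a node $w$ to a node $u$, $\kappa(u)\geq\kappa(w)$ coordinatewise. The cancellation ratio of a matrix is the ratio between the size of a smallest cancellation-free linear circuit computing it and the size of a smallest linear circuit computing it. -}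

module Defs where

open import Data.Bool.Base using (Bool; true; false; _∧_; _xor_) renaming (_≤_ to _≤ᵇ_)
open import Data.Fin.Base using (Fin)
open import Data.Fin.Induction using (spo-wellFounded)
open import Data.Fin.Properties using (_≟_)
open import Data.Integer.Base using (+_)
open import Data.List.Base using (List; length)
open import Data.List.Membership.Propositional using (_∈_)
open import Data.List.Relation.Unary.Unique.Propositional using (Unique)
open import Data.Nat.Base using (ℕ; _≤_; _*_; _^_)
open import Data.Nat.Properties using (m^n≢0)
open import Data.Product.Base using (∃; _×_; _,_; proj₁; proj₂)
open import Data.Rational.Base as ℚ using (ℚ; 0ℚ; ∣_∣)
open import Data.Vec.Base using (Vec; lookup; map; tabulate; zipWith; foldr′)
open import Data.Vec.Relation.Binary.Pointwise.Inductive using (Pointwise)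
open import Function.Bundles using (_⇔_)
open import Induction.WellFounded using (WellFounded; Acc; acc)
open import Level using (0ℓ)
open import Relation.Binary.Construct.Closure.Transitive using (TransClosure; [_]; _++_)
open import Relation.Binary.Core using (Rel)
open import Relation.Binary.PropositionalEquality.Core using (_≡_; _≢_; refl)
open import Relation.Binary.PropositionalEquality.Properties using (isEquivalence)
open import Relation.Binary.Structures using (IsStrictPartialOrder)
open import Relation.Nullary.Decidable.Core using (does)
open import Relation.Nullary.Negation.Core using (¬_)
open import Relation.Unary using (Pred)

-- 𝔽₂ is Bool with _xor_ as addition and _∧_ as multiplication.

𝔽₂^ : ℕ → Set
𝔽₂^ n = Vec Bool n

-- A matrix is the vector of its rows.
Matrix : ℕ → Set
Matrix n = Vec (𝔽₂^ n) n

_·_ : ∀ {n} → 𝔽₂^ n → 𝔽₂^ n → Bool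
a · x = foldr′ _xor_ false (zipWith _∧_ a x)

_*ᵥ_ : ∀ {n} → Matrix n → 𝔽₂^ n → 𝔽₂^ n
A *ᵥ x = map (_· x) A

unit : ∀ {n} → Fin n → 𝔽₂^ n
unit i = tabulate (λ j → does (i ≟ j))

data Node (n s : ℕ) : Set where
  input : Fin n → Node n s
  gate  : Fin s → Node n s

-- A gate is given by its two children.
module Graph {n s : ℕ} (gates : Vec (Node n s × Node n s) s) where

  child₁ child₂ : Fin s → Node n s
  child₁ g = proj₁ (lookup gates g)
  child₂ g = proj₂ (lookup gates g)

  data _⟶_ : Rel (Node n s) 0ℓ where
    edge₁ : ∀ {w g} → w ≡ child₁ g → w ⟶ gate g
    edge₂ : ∀ {w g} → w ≡ child₂ g → w ⟶ gate g

  _⟶⁺_ : Rel (Node n s) 0ℓ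
  _⟶⁺_ = TransClosure _⟶_

  Acyclic : Set
  Acyclic = ∀ u → ¬ (u ⟶⁺ u)

  module _ (acyclic : Acyclic) where

    private
      _⊏_ : Rel (Fin s) 0ℓ
      g ⊏ h = gate g ⟶⁺ gate h

      ⊏-isStrictPartialOrder : IsStrictPartialOrder _≡_ _⊏_
      ⊏-isStrictPartialOrder = record
        { isEquivalence = isEquivalence
        ; irrefl        = λ { refl → acyclic _ }
        ; trans         = _++_
        ; <-resp-≈      = (λ { refl p → p }) , (λ { refl p → p })
        }

      accessible : ∀ {g} → Acc _⊏_ g → Acc _⟶_ (gate g)
      accessible {g} (acc rs) = acc below
        where
        below : ∀ {w} → w ⟶ gate g → Acc _⟶_ w
        below {input _} _ = acc λ ()
        below {gate _}  e = accessible (rs [ e ])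

    ⟶-wellFounded : WellFounded _⟶_
    ⟶-wellFounded (input _) = acc λ ()
    ⟶-wellFounded (gate g)  = accessible (spo-wellFounded ⊏-isStrictPartialOrder g)

  module _ {V : Set} (_⊕_ : V → V → V) (ρ : Fin n → V) where

    evaluateAcc : ∀ u → Acc _⟶_ u → V
    evaluateAcc (input i) _        = ρ i
    evaluateAcc (gate g)  (acc rs) =
      evaluateAcc (child₁ g) (rs (edge₁ refl)) ⊕ evaluateAcc (child₂ g) (rs (edge₂ refl))

-- Linear circuits with n inputs, n outputs and s gates.  Outputs may be
-- inputs, and one node may serve as several outputs.
record Circuit (n s : ℕ) : Set where
  field
    gates   : Vec (Node n s × Node n s) s
    outputs : Vec (Node n s) n

  open Graph gates public

  field
    distinct : ∀ g → child₁ g ≢ child₂ g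
    acyclic  : Acyclic

  evaluate : {V : Set} → (V → V → V) → (Fin n → V) → Node n s → V
  evaluate _⊕_ ρ u = evaluateAcc _⊕_ ρ u (⟶-wellFounded acyclic u)

  value : 𝔽₂^ n → Node n s → Bool
  value x = evaluate _xor_ (lookup x)

  -- The parity computed at a node, as a formal sum of input variables.
  κ : Node n s → 𝔽₂^ n
  κ = evaluate (zipWith _xor_) unit

  Computes : Matrix n → Set
  Computes A = ∀ x → map (value x) outputs ≡ A *ᵥ x

  CancellationFree : Set
  CancellationFree = ∀ w u → w ⟶⁺ u → Pointwise _≤ᵇ_ (κ w) (κ u)

open Circuit using (Computes; CancellationFree)

IsLeast : Pred ℕ 0ℓ → Pred ℕ 0ℓ
IsLeast P m = P m × (∀ k → P k → m ≤ k)

module _ {n : ℕ} (A : Matrix n) where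

  LinearSize : Pred ℕ 0ℓ
  LinearSize s = ∃ λ (C : Circuit n s) → Computes C A

  CancellationFreeSize : Pred ℕ 0ℓ
  CancellationFreeSize s = ∃ λ (C : Circuit n s) → CancellationFree C × Computes C A

-- A matrix with a zero row has no cancellation-free circuit, hence never
-- satisfies this predicate.
CancellationRatio≤ : ℕ → ∀ {n} → Pred (Matrix n) 0ℓ
CancellationRatio≤ c A = ∃ λ s → ∃ λ t →
  IsLeast (CancellationFreeSize A) s × IsLeast (LinearSize A) t × s ≤ c * t

-- q is the fraction of the 2 ^ (n * n) Boolean n × n matrices satisfying P.
IsFraction : ∀ {n} → Pred (Matrix n) 0ℓ → ℚ → Set
IsFraction {n} P q = ∃ λ (As : List (Matrix n)) →
  Unique As × (∀ A → A ∈ As ⇔ P A) ×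
  q ≡ ℚ._/_ (+ length As) (2 ^ (n * n)) {{m^n≢0 2 (n * n)}}

_ConvergesTo_ : (ℕ → ℚ) → ℚ → Set
f ConvergesTo l =
  ∀ ε → 0ℚ ℚ.< ε → ∃ λ N → ∀ n → N ≤ n → ∣ f n ℚ.- l ∣ ℚ.< ε

{-# OPTIONS --safe #-}

-- Call a matrix exceptional if it has a zero row or a linear circuit with O(n²/log n) gates for a
-- small constant.  Only a fraction (n+1)/2ⁿ of the matrices is exceptional: the first kind makes
-- up at most n/2ⁿ of all matrices, and the second kind is rare by Shannon's counting argument,
-- since a circuit is determined by its list of gates and outputs.  If all rows are nonzero, cut
-- the n inputs into blocks of about log n inputs, compute all sums over subsets of each block (at
-- most n gates per block), and add up one such sum per block for every row.  All these sums have
-- disjoint supports, so the circuit is cancellation-free, and it has O(n²/log n) gates.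
-- For the fraction to be a number the predicate must be decidable; minimal sizes are found by
-- exhaustive search over circuits.

module Submission where

open import Defs
open import Algebra.Bundles using (CommutativeRing)
open import Data.Bool.Base using (Bool; true; false; _∧_; _∨_; _xor_; b≤b) renaming (_≤_ to _≤ᵇ_)
open import Data.Bool.ListAction using (any)
open import Data.Bool.Properties
  using (∧-comm; ∧-distribʳ-xor; ∧-zeroʳ; ∨-identityʳ; xor-identityʳ; xor-∧-commutativeRing)
  renaming (_≟_ to _≟ᵇ_; _≤?_ to _≤ᵇ?_; ≤-trans to ≤ᵇ-trans; ≤-minimum to ≤ᵇ-minimum; ≤-maximum to ≤ᵇ-maximum)
open import Data.Fin.Base using (Fin; zero; suc; toℕ)
open import Data.Fin.Properties using (_≟_; all?; any?; injective⇒≤; toℕ<n; toℕ-injective)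
open import Data.Integer.Base as ℤ using (-[1+_]; +<+)
import Data.Integer.Properties as ℤ
open import Data.List.Base as List
  using (List; []; _∷_; length; _++_; allFin; cartesianProduct; cartesianProductWith; concat;
        concatMap; drop; filter; take; upTo)
open import Data.List.Membership.Propositional using (_∈_; find; lose)
open import Data.List.Membership.Propositional.Properties
  using (∈-++⁺ˡ; ∈-++⁺ʳ; ∈-++⁻; ∈-allFin; ∈-cartesianProduct⁺; ∈-cartesianProductWith⁺;
        ∈-concatMap⁺; ∈-filter⁺; ∈-filter⁻; ∈-lookup; ∈-map⁺; ∈-map⁻; ∈-upTo⁺; ∈-upTo⁻)
open import Data.List.Properties
  using (++-identityʳ; filter-++; length-++; length-drop; length-filter; length-map;
        length-tabulate; length-take; length-upTo; take++drop≡id)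
open import Data.List.Relation.Binary.Sublist.Propositional using (_⊆_; []; _∷_; _∷ʳ_; ⊆-refl)
open import Data.List.Relation.Binary.Sublist.Propositional.Properties
  using (All-resp-⊆; ++⁺ˡ; ++⁺ʳ; filter-⊆)
open import Data.List.Relation.Unary.All as All using (All; []; _∷_)
open import Data.List.Relation.Unary.AllPairs using ([]; _∷_)
open import Data.List.Relation.Unary.Any as Any using (here; there; index)
open import Data.List.Relation.Unary.Any.Properties using (lookup-index)
open import Data.List.Relation.Unary.Unique.Propositional using (Unique)
open import Data.List.Relation.Unary.Unique.Propositional.Properties
  using (allFin⁺; cartesianProductWith⁺; filter⁺)
open import Data.Nat.Base using (ℕ; zero; suc; _+_; _*_; _^_; _∸_; _/_; _%_; _⊔_; _≤_; _<_; z≤n; s≤s; NonZero)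
open import Data.Nat.DivMod using (m/n*n≤m; m%n<n; m≡m%n+[m/n]*n)
import Data.Nat.Properties as ℕ
open import Data.Nat.Tactic.RingSolver using (solve-∀)
open import Data.Product.Base using (∃; _×_; _,_; proj₁; proj₂)
open import Data.Rational.Base as ℚ using (ℚ; mkℚ; 0ℚ; 1ℚ)
open import Data.Rational.Properties using (toℚᵘ-cancel-<; toℚᵘ-fromℚᵘ; toℚᵘ-homo-+; toℚᵘ-homo-∣-∣)
open import Data.Rational.Unnormalised.Base as ℚᵘ using (mkℚᵘ; *<*)
import Data.Rational.Unnormalised.Properties as ℚᵘ
open import Data.Sum.Base using (_⊎_; inj₁; inj₂)
open import Data.Vec.Base as Vec using (Vec; []; _∷_; insertAt; removeAt; tabulate; zipWith)
open import Data.Vec.Properties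
  using (≡-dec; ∷-injective; insertAt-removeAt; lookup∘tabulate; lookup-replicate; lookup-zipWith;
        tabulate-cong)
  renaming (lookup-map to lookup-mapᵛ)
open import Data.Vec.Relation.Binary.Pointwise.Inductive as Pointwise using (Pointwise)
open import Function.Base using (_∘_; const; id)
open import Function.Bundles using (_⇔_; mk⇔)
open import Induction.WellFounded using (Acc; acc; WellFounded)
open import Level using (0ℓ)
open import Relation.Binary.Construct.Closure.Transitive
  using ([_]; _∷_) renaming (wellFounded to ⁺-wellFounded)
open import Relation.Binary.PropositionalEquality
  using (_≡_; _≢_; refl; sym; trans; cong; cong₂; subst; subst₂; module ≡-Reasoning)
open import Relation.Nullary using (¬_; Dec; yes; no; does; contradiction)
open import Relation.Nullary.Decidable using (dec-true; map′; _×-dec_; ¬?)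
open import Relation.Unary using (Pred; Decidable)
open Circuit using (Computes; CancellationFree)

private variable
  n s t : ℕ

-- Evaluation of circuits and decidability of the size predicates

lookup-ext : {A : Set} {xs ys : Vec A n} → (∀ i → Vec.lookup xs i ≡ Vec.lookup ys i) → xs ≡ ys
lookup-ext {xs = []}    {[]}    _ = refl
lookup-ext {xs = _ ∷ _} {_ ∷ _} h = cong₂ _∷_ (h zero) (lookup-ext (h ∘ suc))

·-distribʳ-xor : (x a b : 𝔽₂^ n) → zipWith _xor_ a b · x ≡ (a · x) xor (b · x)
·-distribʳ-xor []      []      []      = refl
·-distribʳ-xor (x ∷ xs) (a ∷ as) (b ∷ bs) = begin
  ((a xor b) ∧ x) xor (zipWith _xor_ as bs · xs)
    ≡⟨ cong₂ _xor_ (∧-distribʳ-xor x a b) (·-distribʳ-xor xs as bs) ⟩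
  ((a ∧ x) xor (b ∧ x)) xor ((as · xs) xor (bs · xs))
    ≡⟨ interchange (a ∧ x) (b ∧ x) (as · xs) (bs · xs) ⟩
  ((a ∧ x) xor (as · xs)) xor ((b ∧ x) xor (bs · xs)) ∎
  where
  open ≡-Reasoning
  open import Algebra.Properties.CommutativeSemigroup
    (CommutativeRing.+-commutativeSemigroup xor-∧-commutativeRing) using (interchange)

0·x≡false : (x : 𝔽₂^ n) → tabulate (const false) · x ≡ false
0·x≡false []       = refl
0·x≡false (_ ∷ xs) = 0·x≡false xs

·-comm : (a x : 𝔽₂^ n) → a · x ≡ x · a
·-comm []       []       = refl
·-comm (a ∷ as) (x ∷ xs) = cong₂ _xor_ (∧-comm a x) (·-comm as xs)

unit-· : (i : Fin n) (x : 𝔽₂^ n) → unit i · x ≡ Vec.lookup x i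
unit-· zero    (x ∷ xs) = trans (cong (x xor_) (0·x≡false xs)) (xor-identityʳ x)
unit-· (suc i) (x ∷ xs) = unit-· i xs

·-unit : (a : 𝔽₂^ n) (i : Fin n) → a · unit i ≡ Vec.lookup a i
·-unit a i = trans (·-comm a (unit i)) (unit-· i a)

module _ {n s} (gates : Vec (Node n s × Node n s) s) where

  open Graph gates

  module _ {V : Set} (_⊕_ : V → V → V) (ρ : Fin n → V) where

    -- Serves to verify closed forms: `κ u · x` for `value`, and indicator vectors of supports for
    -- `κ`.
    evaluateAcc-unique : (F : Node n s → V) → (∀ i → F (input i) ≡ ρ i) →
      (∀ g → F (gate g) ≡ F (child₁ g) ⊕ F (child₂ g)) →
      ∀ u (a : Acc _⟶_ u) → evaluateAcc _⊕_ ρ u a ≡ F u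
    evaluateAcc-unique F Fᵢ Fg (input i) a        = sym (Fᵢ i)
    evaluateAcc-unique F Fᵢ Fg (gate g)  (acc rs) = trans
      (cong₂ _⊕_ (evaluateAcc-unique F Fᵢ Fg _ _) (evaluateAcc-unique F Fᵢ Fg _ _)) (sym (Fg g))

    -- Circuits with the same gates may carry different acyclicity proofs, hence different
    -- accessibility proofs; their evaluations must still be comparable.
    evaluateAcc-irrelevant : ∀ u (a b : Acc _⟶_ u) → evaluateAcc _⊕_ ρ u a ≡ evaluateAcc _⊕_ ρ u b
    evaluateAcc-irrelevant (input i) _        _        = refl
    evaluateAcc-irrelevant (gate g)  (acc rs) (acc qs) =
      cong₂ _⊕_ (evaluateAcc-irrelevant (child₁ g) _ _) (evaluateAcc-irrelevant (child₂ g) _ _)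

    evaluateAcc-gate : (wf : WellFounded _⟶_) → ∀ g (a : Acc _⟶_ (gate g)) →
      evaluateAcc _⊕_ ρ (gate g) a ≡
      evaluateAcc _⊕_ ρ (child₁ g) (wf _) ⊕ evaluateAcc _⊕_ ρ (child₂ g) (wf _)
    evaluateAcc-gate wf g (acc rs) =
      cong₂ _⊕_ (evaluateAcc-irrelevant (child₁ g) _ _) (evaluateAcc-irrelevant (child₂ g) _ _)

  -- `Acyclic` speaks of all paths and offers nothing to search. A depth bound is a finite
  -- certificate, decided by recursion on the bound.
  data DepthAtMost : ℕ → Node n s → Set where
    input : ∀ {d i} → DepthAtMost d (input i)
    gate  : ∀ {d g} → DepthAtMost d (child₁ g) → DepthAtMost d (child₂ g) → DepthAtMost (suc d) (gate g)

  depthAtMost? : ∀ d u → Dec (DepthAtMost d u)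
  depthAtMost? d       (input i) = yes input
  depthAtMost? zero    (gate g)  = no λ ()
  depthAtMost? (suc d) (gate g)  = map′ (λ (p , q) → gate p q) (λ { (gate p q) → p , q })
    (depthAtMost? d (child₁ g) ×-dec depthAtMost? d (child₂ g))

  weaken : ∀ {d e u} → d ≤ e → DepthAtMost d u → DepthAtMost e u
  weaken _         input      = input
  weaken (s≤s d≤e) (gate p q) = gate (weaken d≤e p) (weaken d≤e q)

  depthAtMost⇒acc : ∀ {d u} → DepthAtMost d u → Acc _⟶_ u
  depthAtMost⇒acc input      = acc λ ()
  depthAtMost⇒acc (gate p q) = acc λ where
    (edge₁ refl) → depthAtMost⇒acc p
    (edge₂ refl) → depthAtMost⇒acc q

  acc⇒irrefl : ∀ {u} → Acc _⟶⁺_ u → ¬ (u ⟶⁺ u)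
  acc⇒irrefl (acc rs) p = acc⇒irrefl (rs p) p

  module _ (wf : WellFounded _⟶_) where

    depth : Node n s → ℕ
    depth u = evaluateAcc (λ d e → suc (d ⊔ e)) (const 0) u (wf u)

    depth-gate : ∀ g → depth (gate g) ≡ suc (depth (child₁ g) ⊔ depth (child₂ g))
    depth-gate g = evaluateAcc-gate _ _ wf g (wf (gate g))

    depthAtMost-depth : ∀ u → Acc _⟶_ u → DepthAtMost (depth u) u
    depthAtMost-depth (input i) _        = input
    depthAtMost-depth (gate g)  (acc rs) = subst (λ d → DepthAtMost d (gate g)) (sym (depth-gate g))
      (gate (weaken (ℕ.m≤m⊔n _ _) (depthAtMost-depth _ (rs (edge₁ refl))))
            (weaken (ℕ.m≤n⊔m (depth (child₁ g)) _) (depthAtMost-depth _ (rs (edge₂ refl)))))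

    -- Passing to a deeper child lowers the depth by exactly one, so the descent cannot skip the
    -- value `suc d`.
    gate-of-depth : ∀ u → Acc _⟶_ u → ∀ {d} → d < depth u → ∃ λ g → depth (gate g) ≡ suc d
    gate-of-depth (gate g) (acc rs) {d} d<
      with ℕ.m≤n⇒m<n∨m≡n (ℕ.≤-pred (subst (d <_) (depth-gate g) d<))
    ... | inj₂ refl = g , depth-gate g
    ... | inj₁ d<⊔ with ℕ.⊔-sel (depth (child₁ g)) (depth (child₂ g))
    ...   | inj₁ eq = gate-of-depth (child₁ g) (rs (edge₁ refl)) (subst (d <_) eq d<⊔)
    ...   | inj₂ eq = gate-of-depth (child₂ g) (rs (edge₂ refl)) (subst (d <_) eq d<⊔)

    -- Every depth from 1 to depth u is attained by a gate, and distinct depths by distinct gates.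
    depth≤s : ∀ u → depth u ≤ s
    depth≤s u = injective⇒≤ {f = proj₁ ∘ witness} λ {i} {j} eq →
      toℕ-injective (ℕ.suc-injective
        (trans (sym (proj₂ (witness i))) (trans (cong (depth ∘ gate) eq) (proj₂ (witness j)))))
      where
      witness : (i : Fin (depth u)) → ∃ λ g → depth (gate g) ≡ suc (toℕ i)
      witness i = gate-of-depth u (wf u) (toℕ<n i)

  -- By `depth≤s` the bound `s` loses no acyclic graph; conversely, bounded depth gives
  -- well-foundedness, and a well-founded relation has no cycle.
  acyclic? : Dec Acyclic
  acyclic? = map′ to from (all? λ g → depthAtMost? s (gate g))
    where
    to : (∀ g → DepthAtMost s (gate g)) → Acyclic
    to h u = acc⇒irrefl (⁺-wellFounded _⟶_ wf u)
      where
      wf : WellFounded _⟶_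
      wf (input i) = acc λ ()
      wf (gate g)  = depthAtMost⇒acc (h g)

    from : Acyclic → ∀ g → DepthAtMost s (gate g)
    from a g = weaken (depth≤s wf (gate g)) (depthAtMost-depth wf (gate g) (wf (gate g)))
      where wf = ⟶-wellFounded a

module _ {n s} (C : Circuit n s) where

  open Circuit C hiding (Computes; CancellationFree)

  evaluate-gate : ∀ {V : Set} (_⊕_ : V → V → V) ρ g →
    evaluate _⊕_ ρ (gate g) ≡ evaluate _⊕_ ρ (child₁ g) ⊕ evaluate _⊕_ ρ (child₂ g)
  evaluate-gate _⊕_ ρ g =
    evaluateAcc-gate gates _⊕_ ρ (⟶-wellFounded acyclic) g (⟶-wellFounded acyclic (gate g))

  -- The product with a fixed `x` is additive, so `κ u · x` satisfies the recursion that defines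
  -- `value x`.
  value≡κ· : ∀ x u → value x u ≡ κ u · x
  value≡κ· x u = evaluateAcc-unique gates _xor_ (Vec.lookup x) (λ u → κ u · x)
    (λ i → unit-· i x)
    (λ g → trans (cong (_· x) (evaluate-gate (zipWith _xor_) unit g)) (·-distribʳ-xor x (κ (child₁ g)) (κ (child₂ g))))
    u (⟶-wellFounded acyclic u)

  -- Transitivity of the order reduces the condition on paths to one on edges, of which there are
  -- finitely many.
  Monotone : Set
  Monotone = ∀ g → Pointwise _≤ᵇ_ (κ (child₁ g)) (κ (gate g)) × Pointwise _≤ᵇ_ (κ (child₂ g)) (κ (gate g))

  monotone? : Dec Monotone
  monotone? = all? λ g → Pointwise.decidable _≤ᵇ?_ _ _ ×-dec Pointwise.decidable _≤ᵇ?_ _ _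

  monotone⇒cancellationFree : Monotone → CancellationFree C
  monotone⇒cancellationFree m _ _ [ e ]   = step e
    where
    step : ∀ {w u} → w ⟶ u → Pointwise _≤ᵇ_ (κ w) (κ u)
    step (edge₁ {g = g} refl) = proj₁ (m g)
    step (edge₂ {g = g} refl) = proj₂ (m g)
  monotone⇒cancellationFree m w u (e ∷ p) =
    Pointwise.trans ≤ᵇ-trans (monotone⇒cancellationFree m _ _ [ e ]) (monotone⇒cancellationFree m _ u p)

  cancellationFree? : Dec (CancellationFree C)
  cancellationFree? = map′ monotone⇒cancellationFree
    (λ cf g → cf _ _ [ edge₁ refl ] , cf _ _ [ edge₂ refl ]) monotone?

  -- First children lead down to an input, whose value vector is a unit vector; monotonicity carries
  -- its coordinate `true` back up.
  cancellationFree⇒κ≢0 : CancellationFree C → ∀ u → ∃ λ i → Vec.lookup (κ u) i ≡ true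
  cancellationFree⇒κ≢0 cf u = go u (⟶-wellFounded acyclic u)
    where
    true≤ : ∀ {b c} → b ≤ᵇ c → b ≡ true → c ≡ true
    true≤ b≤b eq = eq

    go : ∀ u → Acc _⟶_ u → ∃ λ i → Vec.lookup (κ u) i ≡ true
    go (input i) _        = i , trans (lookup∘tabulate _ i) (dec-true (i ≟ i) refl)
    go (gate g)  (acc rs) with go (child₁ g) (rs (edge₁ refl))
    ... | i , eq = i , true≤ (Pointwise.lookup (cf _ _ [ edge₁ refl ]) i) eq

-- Exhaustive lists of vectors, nodes and circuits

vectors : {A : Set} → List A → ∀ n → List (Vec A n)
vectors xs zero    = [] ∷ []
vectors xs (suc n) = cartesianProductWith _∷_ xs (vectors xs n)

length-cartesianProductWith : {A B C : Set} (f : A → B → C) (xs : List A) (ys : List B) →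
  length (cartesianProductWith f xs ys) ≡ length xs * length ys
length-cartesianProductWith f []       ys = refl
length-cartesianProductWith f (x ∷ xs) ys = trans (length-++ (List.map (f x) ys))
  (cong₂ _+_ (length-map (f x) ys) (length-cartesianProductWith f xs ys))

module _ {A : Set} {xs : List A} where

  ∈-vectors : (∀ x → x ∈ xs) → (v : Vec A n) → v ∈ vectors xs n
  ∈-vectors all []      = here refl
  ∈-vectors all (x ∷ v) = ∈-cartesianProductWith⁺ _∷_ (all x) (∈-vectors all v)

  length-vectors : ∀ n → length (vectors xs n) ≡ length xs ^ n
  length-vectors zero    = refl
  length-vectors (suc n) = trans (length-cartesianProductWith _∷_ xs (vectors xs n))
    (cong (length xs *_) (length-vectors n))

  ∃? : (∀ x → x ∈ xs) → {P : A → Set} → Decidable P → Dec (∃ P)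
  ∃? all P? = map′ (λ p → let x , _ , px = find p in x , px) (λ (x , px) → lose (all x) px) (Any.any? P? xs)

  ∀? : (∀ x → x ∈ xs) → {P : A → Set} → Decidable P → Dec (∀ x → P x)
  ∀? all P? = map′ (λ ps x → All.lookup ps (all x)) (λ p → All.tabulate λ {x} _ → p x) (All.all? P? xs)

bits : List Bool
bits = true ∷ false ∷ []

∈-bits : ∀ b → b ∈ bits
∈-bits true  = here refl
∈-bits false = there (here refl)

nodes : ∀ n s → List (Node n s)
nodes n s = List.map input (allFin n) ++ List.map gate (allFin s)

∈-nodes : (u : Node n s) → u ∈ nodes n s
∈-nodes (input i) = ∈-++⁺ˡ (∈-map⁺ input (∈-allFin i))
∈-nodes (gate g)  = ∈-++⁺ʳ _ (∈-map⁺ gate (∈-allFin g))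

length-nodes : ∀ n s → length (nodes n s) ≡ n + s
length-nodes n s = trans (length-++ (List.map input (allFin n))) (cong₂ _+_
  (trans (length-map input (allFin n)) (length-tabulate {n = n} id))
  (trans (length-map gate (allFin s)) (length-tabulate {n = s} id)))

-- The data of a circuit without its proofs, so that all candidates, cyclic ones included, form an
-- explicit finite list.
RawCircuit : ℕ → ℕ → Set
RawCircuit n s = Vec (Node n s × Node n s) s × Vec (Node n s) n

rawCircuits : ∀ n s → List (RawCircuit n s)
rawCircuits n s = cartesianProduct (vectors (cartesianProduct (nodes n s) (nodes n s)) s) (vectors (nodes n s) n)

∈-rawCircuits : (r : RawCircuit n s) → r ∈ rawCircuits n s
∈-rawCircuits (gs , os) = ∈-cartesianProduct⁺
  (∈-vectors (λ (u , v) → ∈-cartesianProduct⁺ (∈-nodes u) (∈-nodes v)) gs) (∈-vectors ∈-nodes os)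

-- Each of the `s` gates picks two of the `n + s` nodes, and each of the `n` outputs picks one.
length-rawCircuits : ∀ n s → length (rawCircuits n s) ≡ ((n + s) * (n + s)) ^ s * (n + s) ^ n
length-rawCircuits n s = trans
  (length-cartesianProductWith _,_ (vectors (cartesianProduct (nodes n s) (nodes n s)) s) (vectors (nodes n s) n)) (cong₂ _*_
  (trans (length-vectors s) (cong (_^ s) (trans (length-cartesianProductWith _,_ (nodes n s) (nodes n s))
    (cong₂ _*_ (length-nodes n s) (length-nodes n s)))))
  (trans (length-vectors n) (cong (_^ n) (length-nodes n s))))

raw : Circuit n s → RawCircuit n s
raw C = Circuit.gates C , Circuit.outputs C

evaluate-raw : (C D : Circuit n s) → raw C ≡ raw D → {V : Set} (_⊕_ : V → V → V) (ρ : Fin n → V) →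
  ∀ u → Circuit.evaluate C _⊕_ ρ u ≡ Circuit.evaluate D _⊕_ ρ u
-- After matching, the circuits differ only in their proofs, which affect nothing but the
-- accessibility argument.
evaluate-raw C@record{} D@record{} refl _⊕_ ρ u = evaluateAcc-irrelevant (Circuit.gates C) _⊕_ ρ u _ _

cancellationFree-raw : (C D : Circuit n s) → raw C ≡ raw D → CancellationFree C → CancellationFree D
cancellationFree-raw C@record{} D@record{} refl cf w u p =
  subst₂ (Pointwise _≤ᵇ_) (evaluate-raw C D refl _ _ w) (evaluate-raw C D refl _ _ u) (cf w u p)

computes-raw : ∀ {A} (C D : Circuit n s) → raw C ≡ raw D → Computes C A → Computes D A
computes-raw C@record{} D@record{} refl h x =
  trans (lookup-ext λ i → trans (lookup-mapᵛ i _ (Circuit.outputs C))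
    (trans (sym (evaluate-raw C D refl _ _ (Vec.lookup (Circuit.outputs C) i)))
           (sym (lookup-mapᵛ i _ (Circuit.outputs C))))) (h x)

-- Unit vectors read off the entries of a matrix. Hence a circuit can serve as a code for the matrix
-- it computes.
computes-unique : ∀ {A B} (C : Circuit n s) → Computes C A → Computes C B → A ≡ B
computes-unique {A = A} {B} C hA hB = lookup-ext λ i → lookup-ext λ j → begin
  Vec.lookup (Vec.lookup A i) j      ≡⟨ ·-unit (Vec.lookup A i) j ⟨
  Vec.lookup A i · unit j            ≡⟨ lookup-mapᵛ i _ A ⟨
  Vec.lookup (A *ᵥ unit j) i         ≡⟨ cong (λ v → Vec.lookup v i) (trans (sym (hA (unit j))) (hB (unit j))) ⟩
  Vec.lookup (B *ᵥ unit j) i         ≡⟨ lookup-mapᵛ i _ B ⟩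
  Vec.lookup B i · unit j            ≡⟨ ·-unit (Vec.lookup B i) j ⟩
  Vec.lookup (Vec.lookup B i) j      ∎
  where open ≡-Reasoning

_≟ᴺ_ : (u v : Node n s) → Dec (u ≡ v)
input i ≟ᴺ input j = map′ (cong input) (λ { refl → refl }) (i ≟ j)
input i ≟ᴺ gate h  = no λ ()
gate g  ≟ᴺ input j = no λ ()
gate g  ≟ᴺ gate h  = map′ (cong gate) (λ { refl → refl }) (g ≟ h)

computes? : (C : Circuit n s) (A : Matrix n) → Dec (Computes C A)
computes? {n} C A = ∀? (∈-vectors {n = n} ∈-bits) λ x → ≡-dec _≟ᵇ_ _ _

-- A predicate on circuits that ignores the proofs stored in them can be decided by trying all
-- pairs of gates and outputs.
∃circuit? : {P : Circuit n s → Set} → (∀ C D → raw C ≡ raw D → P C → P D) →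
  (∀ C → Dec (P C)) → Dec (∃ P)
∃circuit? {n} {s} {P} P-raw P? = map′ (λ (_ , C , _ , p) → C , p) (λ (C , p) → raw C , C , refl , p)
  (∃? ∈-rawCircuits realised?)
  where
  realised? : (r : RawCircuit n s) → Dec (∃ λ C → raw C ≡ r × P C)
  realised? (gs , os)
    with all? (λ g → ¬? (Graph.child₁ gs g ≟ᴺ Graph.child₂ gs g)) | acyclic? gs
  ... | no ¬d | _     = no λ { (C , refl , _) → ¬d (Circuit.distinct C) }
  ... | yes _ | no ¬a = no λ { (C , refl , _) → ¬a (Circuit.acyclic C) }
  ... | yes d | yes a = map′ (λ p → _ , refl , p) (λ (C , eq , p) → P-raw C _ eq p)
    (P? record { gates = gs ; outputs = os ; distinct = d ; acyclic = a })

module _ (A : Matrix n) where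

  opaque

    linearSize? : Decidable (LinearSize A)
    linearSize? s = ∃circuit? computes-raw (λ C → computes? C A)

    cancellationFreeSize? : Decidable (CancellationFreeSize A)
    cancellationFreeSize? s = ∃circuit?
      (λ C D eq (cf , h) → cancellationFree-raw C D eq cf , computes-raw C D eq h)
      (λ C → cancellationFree? C ×-dec computes? C A)

  -- The output for row `i` would have value vector zero, contrary to `cancellationFree⇒κ≢0`.
  zero-row⇒¬cancellationFreeSize : ∀ {i} → Vec.lookup A i ≡ Vec.replicate n false → ¬ CancellationFreeSize A s
  zero-row⇒¬cancellationFreeSize {i = i} Aᵢ≡0 (C , cf , h) with cancellationFree⇒κ≢0 C cf (Vec.lookup (Circuit.outputs C) i)
  ... | j , κⱼ≡true = contradiction (trans (sym κⱼ≡true) κⱼ≡false) λ ()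
    where
    open ≡-Reasoning
    open Circuit C using (κ; value; outputs)
    u = Vec.lookup outputs i
    κⱼ≡false : Vec.lookup (κ u) j ≡ false
    κⱼ≡false = begin
      Vec.lookup (κ u) j                              ≡⟨ ·-unit (κ u) j ⟨
      κ u · unit j                                    ≡⟨ value≡κ· C (unit j) u ⟨
      value (unit j) u                                ≡⟨ lookup-mapᵛ i _ outputs ⟨
      Vec.lookup (Vec.map (value (unit j)) outputs) i ≡⟨ cong (λ v → Vec.lookup v i) (h (unit j)) ⟩
      Vec.lookup (A *ᵥ unit j) i                      ≡⟨ lookup-mapᵛ i _ A ⟩
      Vec.lookup A i · unit j                         ≡⟨ cong (_· unit j) Aᵢ≡0 ⟩
      Vec.replicate n false · unit j                  ≡⟨ ·-unit (Vec.replicate n false) j ⟩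
      Vec.lookup (Vec.replicate n false) j            ≡⟨ lookup-replicate j false ⟩
      false                                           ∎

-- Cancellation-free circuits with O(n²/log n) gates

Unique-resp-⊆ : {A : Set} {xs ys : List A} → xs ⊆ ys → Unique ys → Unique xs
Unique-resp-⊆ []          []       = []
Unique-resp-⊆ (_ ∷ʳ τ)    (_ ∷ u)  = Unique-resp-⊆ τ u
Unique-resp-⊆ (refl ∷ τ)  (h ∷ u)  = All-resp-⊆ τ h ∷ Unique-resp-⊆ τ u

_∈ᵇ_ : Fin n → List (Fin n) → Bool
i ∈ᵇ js = any (λ j → does (j ≟ i)) js

∉⇒∈ᵇ≡false : ∀ {i : Fin n} {js} → All (i ≢_) js → i ∈ᵇ js ≡ false
∉⇒∈ᵇ≡false []                = refl
∉⇒∈ᵇ≡false {i = i} (_∷_ {j} h hs) with j ≟ i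
... | yes j≡i = contradiction (sym j≡i) h
... | no _    = ∉⇒∈ᵇ≡false hs

∈ᵇ-++ : ∀ (i : Fin n) js ks → i ∈ᵇ (js ++ ks) ≡ (i ∈ᵇ js) ∨ (i ∈ᵇ ks)
∈ᵇ-++ i []       ks = refl
∈ᵇ-++ i (j ∷ js) ks with j ≟ i
... | yes _ = refl
... | no _  = ∈ᵇ-++ i js ks

-- Uniqueness makes `js` and `ks` disjoint, and for disjoint sets symmetric difference is union.
∈ᵇ-++-xor : ∀ (i : Fin n) js ks → Unique (js ++ ks) → i ∈ᵇ (js ++ ks) ≡ (i ∈ᵇ js) xor (i ∈ᵇ ks)
∈ᵇ-++-xor i []       ks _       = refl
∈ᵇ-++-xor i (j ∷ js) ks (h ∷ u) with j ≟ i
... | no _     = ∈ᵇ-++-xor i js ks u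
... | yes refl rewrite ∉⇒∈ᵇ≡false {js = ks} (All-resp-⊆ (++⁺ˡ js ⊆-refl) h) = refl

∈⇒∈ᵇ : ∀ {i : Fin n} {js} → i ∈ js → i ∈ᵇ js ≡ true
∈⇒∈ᵇ {i = i} {j ∷ js} p with j ≟ i
... | yes _ = refl
∈⇒∈ᵇ (here refl) | no ¬p = contradiction refl ¬p
∈⇒∈ᵇ (there p)   | no _  = ∈⇒∈ᵇ p

≤ᵇ-∨ˡ : ∀ a b → a ≤ᵇ a ∨ b
≤ᵇ-∨ˡ true  b = b≤b
≤ᵇ-∨ˡ false b = ≤ᵇ-minimum b

≤ᵇ-∨ʳ : ∀ a b → b ≤ᵇ a ∨ b
≤ᵇ-∨ʳ true  b = ≤ᵇ-maximum b
≤ᵇ-∨ʳ false b = b≤b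

-- Disjointness of the supports rules out cancellation; nonemptiness makes supports grow along
-- edges, whence acyclicity.
record UnionCircuit (n s : ℕ) : Set where
  field
    gates : Vec (Node n s × Node n s) s

  open Graph gates public

  field
    supp          : Node n s → List (Fin n)
    supp-input    : ∀ i → supp (input i) ≡ i ∷ []
    supp-gate     : ∀ g → supp (gate g) ≡ supp (child₁ g) ++ supp (child₂ g)
    supp-unique   : ∀ u → Unique (supp u)
    supp-nonempty : ∀ u → 0 < length (supp u)

  ⟶⇒supp-shorter : ∀ {w u} → w ⟶ u → length (supp w) < length (supp u)
  ⟶⇒supp-shorter (edge₁ {g = g} refl) rewrite supp-gate g | length-++ (supp (child₁ g)) {supp (child₂ g)} =
    ℕ.m<m+n _ (supp-nonempty (child₂ g))
  ⟶⇒supp-shorter (edge₂ {g = g} refl) rewrite supp-gate g | length-++ (supp (child₁ g)) {supp (child₂ g)} =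
    ℕ.m<n+m _ (supp-nonempty (child₁ g))

  ⟶⁺⇒supp-shorter : ∀ {w u} → w ⟶⁺ u → length (supp w) < length (supp u)
  ⟶⁺⇒supp-shorter [ e ]   = ⟶⇒supp-shorter e
  ⟶⁺⇒supp-shorter (e ∷ p) = ℕ.<-trans (⟶⇒supp-shorter e) (⟶⁺⇒supp-shorter p)

  supp-children-unique : ∀ g → Unique (supp (child₁ g) ++ supp (child₂ g))
  supp-children-unique g = subst Unique (supp-gate g) (supp-unique (gate g))

  -- A common child would give the support `js ++ js` with `js` nonempty, which has a repetition.
  children-distinct : ∀ g → child₁ g ≢ child₂ g
  children-distinct g eq = impossible (supp (child₁ g)) (supp-nonempty (child₁ g))
    (subst (λ w → Unique (supp (child₁ g) ++ supp w)) (sym eq) (supp-children-unique g))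
    where
    impossible : ∀ js → 0 < length js → ¬ Unique (js ++ js)
    impossible (j ∷ js) _ (h ∷ _) = All.lookup h (∈-++⁺ʳ js (here refl)) refl

  module _ (outputs : Vec (Node n s) n) where

    toCircuit : Circuit n s
    toCircuit = record
      { gates    = gates
      ; outputs  = outputs
      ; distinct = children-distinct
      ; acyclic  = λ u p → ℕ.<-irrefl refl (⟶⁺⇒supp-shorter p)
      }

    open Circuit toCircuit using (κ; value)

    -- By `∈ᵇ-++-xor` the indicator vectors of supports obey the recursion of `κ`.
    κ≡supp : ∀ u → κ u ≡ tabulate (_∈ᵇ supp u)
    κ≡supp u = evaluateAcc-unique gates (zipWith _xor_) unit (λ u → tabulate (_∈ᵇ supp u))
      (λ i → tabulate-cong λ j → trans (cong (j ∈ᵇ_) (supp-input i)) (∨-identityʳ _))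
      (λ g → lookup-ext λ j → begin
        Vec.lookup (tabulate (_∈ᵇ supp (gate g))) j ≡⟨ lookup∘tabulate _ j ⟩
        j ∈ᵇ supp (gate g)
          ≡⟨ cong (j ∈ᵇ_) (supp-gate g) ⟩
        j ∈ᵇ (supp (child₁ g) ++ supp (child₂ g))
          ≡⟨ ∈ᵇ-++-xor j (supp (child₁ g)) (supp (child₂ g)) (supp-children-unique g) ⟩
        (j ∈ᵇ supp (child₁ g)) xor (j ∈ᵇ supp (child₂ g))
          ≡⟨ cong₂ _xor_ (lookup∘tabulate _ j) (lookup∘tabulate _ j) ⟨
        Vec.lookup (tabulate (_∈ᵇ supp (child₁ g))) j xor Vec.lookup (tabulate (_∈ᵇ supp (child₂ g))) j
          ≡⟨ lookup-zipWith _xor_ j (tabulate (_∈ᵇ supp (child₁ g))) (tabulate (_∈ᵇ supp (child₂ g))) ⟨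
        Vec.lookup (zipWith _xor_ (tabulate (_∈ᵇ supp (child₁ g))) (tabulate (_∈ᵇ supp (child₂ g)))) j ∎)
      u _
      where open ≡-Reasoning

    -- Membership in a concatenation is a disjunction, so along an edge indicators can only grow.
    toCircuit-cancellationFree : CancellationFree toCircuit
    toCircuit-cancellationFree = monotone⇒cancellationFree toCircuit λ g →
      κ-mono (λ i → subst ((i ∈ᵇ supp (child₁ g)) ≤ᵇ_) (sym (gate-∨ g i)) (≤ᵇ-∨ˡ _ (i ∈ᵇ supp (child₂ g)))) ,
      κ-mono (λ i → subst ((i ∈ᵇ supp (child₂ g)) ≤ᵇ_) (sym (gate-∨ g i)) (≤ᵇ-∨ʳ (i ∈ᵇ supp (child₁ g)) _))
      where
      gate-∨ : ∀ g i → i ∈ᵇ supp (gate g) ≡ (i ∈ᵇ supp (child₁ g)) ∨ (i ∈ᵇ supp (child₂ g))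
      gate-∨ g i = trans (cong (i ∈ᵇ_) (supp-gate g)) (∈ᵇ-++ i (supp (child₁ g)) (supp (child₂ g)))
      κ-mono : ∀ {w u} → (∀ i → (i ∈ᵇ supp w) ≤ᵇ (i ∈ᵇ supp u)) → Pointwise _≤ᵇ_ (κ w) (κ u)
      κ-mono {w} {u} h rewrite κ≡supp w | κ≡supp u = Pointwise.tabulate⁺ h

    toCircuit-computes : ∀ {A} → (∀ i j → j ∈ᵇ supp (Vec.lookup outputs i) ≡ Vec.lookup (Vec.lookup A i) j) →
      Computes toCircuit A
    toCircuit-computes {A} h x = lookup-ext λ i → begin
      Vec.lookup (Vec.map (value x) outputs) i ≡⟨ lookup-mapᵛ i _ outputs ⟩
      value x (Vec.lookup outputs i)           ≡⟨ value≡κ· toCircuit x (Vec.lookup outputs i) ⟩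
      κ (Vec.lookup outputs i) · x             ≡⟨ cong (_· x) (trans (κ≡supp (Vec.lookup outputs i))
                                                    (lookup-ext {ys = Vec.lookup A i} λ j → trans (lookup∘tabulate _ j) (h i j))) ⟩
      Vec.lookup A i · x                       ≡⟨ lookup-mapᵛ i _ A ⟨
      Vec.lookup (A *ᵥ x) i                    ∎
      where open ≡-Reasoning

open UnionCircuit using (supp; toCircuit; toCircuit-cancellationFree; toCircuit-computes)

-- Building circuits gate by gate within a budget

inputs : UnionCircuit n 0
inputs = record
  { gates         = []
  ; supp          = λ { (input i) → i ∷ [] }
  ; supp-input    = λ _ → refl
  ; supp-gate     = λ ()
  ; supp-unique   = λ { (input i) → [] ∷ [] }
  ; supp-nonempty = λ { (input i) → s≤s z≤n }
  }

module _ (p : UnionCircuit n s) where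

  open UnionCircuit p hiding (supp)

  module _ (u v : Node n s) (uv-unique : Unique (supp p u ++ supp p v)) where

    private
      -- The new gate takes index `zero`, so the old gates move up by one.
      raise : Node n s → Node n (suc s)
      raise (input i) = input i
      raise (gate g)  = gate (suc g)

      gates′ : Vec (Node n (suc s) × Node n (suc s)) (suc s)
      gates′ = (raise u , raise v) ∷ Vec.map (λ (a , b) → raise a , raise b) gates

      supp′ : Node n (suc s) → List (Fin n)
      supp′ (input i)      = supp p (input i)
      supp′ (gate zero)    = supp p u ++ supp p v
      supp′ (gate (suc g)) = supp p (gate g)

      supp′-raise : ∀ w → supp′ (raise w) ≡ supp p w
      supp′-raise (input i) = refl
      supp′-raise (gate g)  = refl

      supp′-gate : ∀ g → supp′ (gate g) ≡ supp′ (Graph.child₁ gates′ g) ++ supp′ (Graph.child₂ gates′ g)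
      supp′-gate zero    = sym (cong₂ _++_ (supp′-raise u) (supp′-raise v))
      supp′-gate (suc g) = trans (supp-gate g) (sym (cong₂ _++_
        (trans (cong (supp′ ∘ proj₁) (lookup-mapᵛ g _ gates)) (supp′-raise (child₁ g)))
        (trans (cong (supp′ ∘ proj₂) (lookup-mapᵛ g _ gates)) (supp′-raise (child₂ g)))))

    addGate : UnionCircuit n (suc s)
    addGate = record
      { gates         = gates′
      ; supp          = supp′
      ; supp-input    = supp-input
      ; supp-gate     = supp′-gate
      ; supp-unique   = λ { (input i) → supp-unique (input i) ; (gate zero) → uv-unique
                          ; (gate (suc g)) → supp-unique (gate g) }
      ; supp-nonempty = λ { (input i) → supp-nonempty (input i)
                          ; (gate zero) → ℕ.≤-trans (supp-nonempty u)
                              (subst (_ ≤_) (sym (length-++ (supp p u))) (ℕ.m≤m+n _ _))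
                          ; (gate (suc g)) → supp-nonempty (gate g) }
      }

    addGate-supp : ∀ w → ∃ λ w′ → supp addGate w′ ≡ supp p w
    addGate-supp w = raise w , supp′-raise w

-- The empty support is the sum 0, which no node needs to compute.
data Available (p : UnionCircuit n s) : Pred (List (Fin n)) 0ℓ where
  empty : Available p []
  node  : ∀ {l} u → supp p u ≡ l → Available p l

-- Node indices shift whenever a gate is added, so growth is recorded by the supports on offer and
-- not by an embedding of nodes.
_⊑_ : UnionCircuit n s → UnionCircuit n t → Set
p ⊑ q = ∀ {l} → Available p l → Available q l

-- The budget `k` counts the gates added to `p`. Only an upper bound on the final size is kept, so
-- that costs can be rounded up and summed.
record Affordable (p : UnionCircuit n s) (k : ℕ) (P : Pred (List (Fin n)) 0ℓ) : Set where
  constructor afford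
  field
    {size}    : ℕ
    size≤     : size ≤ s + k
    extended  : UnionCircuit n size
    extends   : p ⊑ extended
    available : ∀ {l} → P l → Available extended l

singleton-available : (p : UnionCircuit n s) (i : Fin n) → Available p (i ∷ [])
singleton-available p i = node (input i) (UnionCircuit.supp-input p i)

private variable
  P Q : Pred (List (Fin n)) 0ℓ

relax : ∀ {p : UnionCircuit n s} {k m} → k ≤ m → Affordable p k P → Affordable p m P
relax {s = s} k≤m (afford t≤ q p⊑q av) = afford (ℕ.≤-trans t≤ (ℕ.+-monoʳ-≤ s k≤m)) q p⊑q av

available⇒affordable : ∀ {p : UnionCircuit n s} {k} → (∀ {l} → P l → Available p l) → Affordable p k P
available⇒affordable {s = s} {p = p} h = afford (ℕ.m≤m+n s _) p id h

-- The second stage starts from the circuit left by the first and may use its sums, which survive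
-- because extensions keep every support.
affordable-then : ∀ {p : UnionCircuit n s} {k m} → Affordable p k P →
  (∀ {t} (q : UnionCircuit n t) → p ⊑ q → (∀ {l} → P l → Available q l) → Affordable q m Q) →
  Affordable p (k + m) (λ l → P l ⊎ Q l)
affordable-then {s = s} {k = k} {m} (afford t≤ q p⊑q P-av) f with f q p⊑q P-av
... | afford t′≤ q′ q⊑q′ Q-av = afford
  (ℕ.≤-trans t′≤ (ℕ.≤-trans (ℕ.+-monoˡ-≤ m t≤) (ℕ.≤-reflexive (ℕ.+-assoc s k m)))) q′ (q⊑q′ ∘ p⊑q)
  λ { (inj₁ x) → q⊑q′ (P-av x) ; (inj₂ x) → Q-av x }

affordable-⊆ : ∀ {p : UnionCircuit n s} {k} → (∀ {l} → Q l → P l) → Affordable p k P → Affordable p k Q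
affordable-⊆ h (afford t≤ q p⊑q av) = afford t≤ q p⊑q (av ∘ h)

-- Each item must be affordable over every extension of `p`, since it is built after the items
-- before it.
affordable-each : ∀ {p : UnionCircuit n s} {X : Set} {k} (xs : List X) (F : X → Pred (List (Fin n)) 0ℓ) →
  (∀ {x} → x ∈ xs → ∀ {t} (q : UnionCircuit n t) → p ⊑ q → Affordable q k (F x)) →
  Affordable p (length xs * k) (λ l → ∃ λ x → x ∈ xs × F x l)
affordable-each []       F h = available⇒affordable λ ()
affordable-each (x ∷ xs) F h = affordable-⊆
  (λ { (_ , here refl , f) → inj₁ f ; (y , there y∈ , f) → inj₂ (y , y∈ , f) })
  (affordable-then (h (here refl) _ id)
    (λ q p⊑q _ → affordable-each xs F λ y∈ q′ q⊑q′ → h (there y∈) q′ (q⊑q′ ∘ p⊑q)))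

-- One gate adds two nonempty sums; if either is empty, the other is already the result and no gate
-- is spent.
++-affordable : ∀ {p : UnionCircuit n s} {js ks} → Available p js → Available p ks → Unique (js ++ ks) →
  Affordable p 1 (_≡ js ++ ks)
++-affordable empty av _ = available⇒affordable λ { refl → av }
++-affordable {js = js} av@(node _ _) empty _ =
  available⇒affordable λ { refl → subst (Available _) (sym (++-identityʳ js)) av }
++-affordable {s = s} {p = p} (node u refl) (node v refl) uv = afford
  (ℕ.≤-reflexive (ℕ.+-comm 1 s)) (addGate p u v uv)
  (λ { empty         → empty
     ; (node w refl) → let w′ , eq = addGate-supp p u v uv w in node w′ eq })
  λ { refl → node (gate zero) refl }

-- Subset sums of blocks, and rows assembled from them

sublists : {A : Set} → List A → List (List A)
sublists []       = [] ∷ []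
sublists (x ∷ xs) = List.map (x ∷_) (sublists xs) ++ sublists xs

module _ {A : Set} where

  ∈-sublists : {xs ys : List A} → xs ⊆ ys → xs ∈ sublists ys
  ∈-sublists []         = here refl
  ∈-sublists (_ ∷ʳ τ)   = ∈-++⁺ʳ _ (∈-sublists τ)
  ∈-sublists (refl ∷ τ) = ∈-++⁺ˡ (∈-map⁺ _ (∈-sublists τ))

  sublists-⊆ : {xs : List A} (ys : List A) → xs ∈ sublists ys → xs ⊆ ys
  sublists-⊆ []       (here refl) = []
  sublists-⊆ (y ∷ ys) xs∈ with ∈-++⁻ (List.map (y ∷_) (sublists ys)) xs∈
  ... | inj₂ xs∈′ = y ∷ʳ sublists-⊆ ys xs∈′
  ... | inj₁ xs∈′ with ∈-map⁻ (y ∷_) xs∈′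
  ...   | _ , zs∈ , refl = refl ∷ sublists-⊆ ys zs∈

  length-sublists : (xs : List A) → length (sublists xs) ≡ 2 ^ length xs
  length-sublists []       = refl
  length-sublists (x ∷ xs) = begin
    length (List.map (x ∷_) (sublists xs) ++ sublists xs)
      ≡⟨ length-++ (List.map (x ∷_) (sublists xs)) ⟩
    length (List.map (x ∷_) (sublists xs)) + length (sublists xs)
      ≡⟨ cong₂ _+_ (trans (length-map (x ∷_) (sublists xs)) (length-sublists xs)) (length-sublists xs) ⟩
    2 ^ length xs + 2 ^ length xs
      ≡⟨ cong (2 ^ length xs +_) (ℕ.+-identityʳ _) ⟨
    2 * 2 ^ length xs ∎
    where open ≡-Reasoning

-- Sums over the tail come first; adding the head to each of them costs at most one gate, so the
-- budget doubles with every element.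
sublists-affordable : (p : UnionCircuit n s) (js : List (Fin n)) → Unique js → Affordable p (2 ^ length js) (_⊆ js)
sublists-affordable p []       _            = available⇒affordable λ { [] → empty }
sublists-affordable p (j ∷ js) u@(_ ∷ js-u) = relax (ℕ.≤-reflexive size)
  (affordable-⊆ cases (affordable-then (sublists-affordable p js js-u) λ q p⊑q av →
    affordable-each (sublists js) (λ l → _≡ j ∷ l) λ {l} l∈ q′ q⊑q′ →
      ++-affordable (singleton-available q′ j) (q⊑q′ (av (sublists-⊆ js l∈)))
        (Unique-resp-⊆ (refl ∷ sublists-⊆ js l∈) u)))
  where
  size : 2 ^ length js + length (sublists js) * 1 ≡ 2 ^ suc (length js)
  size = cong (2 ^ length js +_) (trans (ℕ.*-comm (length (sublists js)) 1)
    (cong (_+ 0) (length-sublists js)))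
  cases : ∀ {l} → l ⊆ j ∷ js → l ⊆ js ⊎ ∃ λ l′ → l′ ∈ sublists js × l ≡ j ∷ l′
  cases (_ ∷ʳ τ)   = inj₁ τ
  cases (refl ∷ τ) = inj₂ (_ , ∈-sublists τ , refl)

∈⇒⊆-concat : {A : Set} {xs : List A} {xss : List (List A)} → xs ∈ xss → xs ⊆ concat xss
∈⇒⊆-concat (here refl)           = ++⁺ʳ _ ⊆-refl
∈⇒⊆-concat (there {x = xs} xs∈) = ++⁺ˡ xs (∈⇒⊆-concat xs∈)

support : 𝔽₂^ n → List (Fin n) → List (Fin n)
support a = filter (λ i → Vec.lookup a i ≟ᵇ true)

∈ᵇ-support : (a : 𝔽₂^ n) (i : Fin n) (js : List (Fin n)) → i ∈ᵇ support a js ≡ (i ∈ᵇ js) ∧ Vec.lookup a i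
∈ᵇ-support a i []       = refl
∈ᵇ-support a i (j ∷ js) with Vec.lookup a j in eq
... | true with j ≟ i
...   | yes refl = sym eq
...   | no _     = ∈ᵇ-support a i js
∈ᵇ-support a i (j ∷ js) | false with j ≟ i
...   | yes refl = trans (∈ᵇ-support a i js) (trans (cong ((i ∈ᵇ js) ∧_) eq) (trans (∧-zeroʳ (i ∈ᵇ js)) (sym eq)))
...   | no _     = ∈ᵇ-support a i js

∈ᵇ-support-allFin : (a : 𝔽₂^ n) (i : Fin n) → i ∈ᵇ support a (allFin n) ≡ Vec.lookup a i
∈ᵇ-support-allFin a i = trans (∈ᵇ-support a i (allFin _)) (cong (_∧ Vec.lookup a i) (∈⇒∈ᵇ (∈-allFin i)))

-- By `filter-++` the support of `a` splits along the blocks. Each part is a sublist of its block,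
-- hence available, and one gate adds it to the sum of the later parts.
row-affordable : {p : UnionCircuit n s} (a : 𝔽₂^ n) (cs : List (List (Fin n))) → Unique (concat cs) →
  (∀ {l c} → c ∈ cs → l ⊆ c → Available p l) → Affordable p (length cs) (_≡ support a (concat cs))
row-affordable a []       _ _  = available⇒affordable λ { refl → empty }
row-affordable a (c ∷ cs) u av = relax (ℕ.≤-reflexive (ℕ.+-comm (length cs) 1))
  (affordable-⊆ (λ eq → inj₂ (trans eq (filter-++ _ c (concat cs))))
    (affordable-then
      (row-affordable a cs (Unique-resp-⊆ (++⁺ˡ c ⊆-refl) u) (λ c∈ → av (there c∈)))
      λ q p⊑q av′ → ++-affordable (p⊑q (av (here refl) (filter-⊆ _ c))) (av′ refl)
        (subst Unique (filter-++ _ c (concat cs)) (Unique-resp-⊆ (filter-⊆ _ (c ++ concat cs)) u))))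

-- The number of chunks is always `q`; the last ones may be short or empty.
chunks : {A : Set} (q k : ℕ) → List A → List (List A)
chunks zero    k xs = []
chunks (suc q) k xs = take k xs ∷ chunks q k (drop k xs)

module _ {A : Set} where

  length-chunks : ∀ q k (xs : List A) → length (chunks q k xs) ≡ q
  length-chunks zero    k xs = refl
  length-chunks (suc q) k xs = cong suc (length-chunks q k (drop k xs))

  chunk-length : ∀ q k (xs : List A) {c} → c ∈ chunks q k xs → length c ≤ k
  chunk-length (suc q) k xs (here refl) = subst (_≤ k) (sym (length-take k xs)) (ℕ.m⊓n≤m k _)
  chunk-length (suc q) k xs (there c∈)  = chunk-length q k (drop k xs) c∈

  concat-chunks : ∀ q k (xs : List A) → length xs ≤ q * k → concat (chunks q k xs) ≡ xs
  concat-chunks zero    k []      _ = refl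
  concat-chunks (suc q) k xs xs≤ = trans
    (cong (take k xs ++_) (concat-chunks q k (drop k xs)
      (subst (_≤ q * k) (sym (length-drop k xs)) (ℕ.m≤n+o⇒m∸n≤o (length xs) k xs≤))))
    (take++drop≡id k xs)

module _ {A : Matrix n} (A≢0 : ∀ i → Vec.lookup A i ≢ Vec.replicate n false)
         {q k : ℕ} (n≤qk : n ≤ q * k) where

  private
    cs = chunks q k (allFin n)
    concat-cs : concat cs ≡ allFin n
    concat-cs = concat-chunks q k (allFin n) (subst (_≤ q * k) (sym (length-tabulate {n = n} id)) n≤qk)
    cs-unique : Unique (concat cs)
    cs-unique = subst Unique (sym concat-cs) (allFin⁺ n)

  -- First come the subset sums of `q` blocks, at most `2 ^ k` gates each; then each of the `n` rows
  -- adds up one sum per block within `q` gates.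
  rows-affordable : Affordable (inputs {n}) (q * 2 ^ k + n * q) (λ l → ∃ λ i → l ≡ support (Vec.lookup A i) (allFin n))
  rows-affordable = affordable-⊆ (λ (i , eq) → inj₂ (i , ∈-allFin i ,
      trans eq (cong (support (Vec.lookup A i)) (sym concat-cs))))
    (affordable-then
      (relax (ℕ.≤-reflexive (cong (_* 2 ^ k) (length-chunks q k (allFin n))))
        (affordable-each cs (λ c → _⊆ c) λ {c} c∈ q′ _ →
          relax (ℕ.^-monoʳ-≤ 2 (chunk-length q k (allFin n) c∈))
            (sublists-affordable q′ c (Unique-resp-⊆ (∈⇒⊆-concat c∈) cs-unique))))
      λ q₁ _ av → relax (ℕ.≤-reflexive (cong (_* q) (length-tabulate {n = n} id)))
        (affordable-each (allFin n) (λ i → _≡ support (Vec.lookup A i) (concat cs)) λ {i} _ q₂ q₁⊑q₂ →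
          relax (ℕ.≤-reflexive (length-chunks q k (allFin n)))
            (row-affordable (Vec.lookup A i) cs cs-unique λ c∈ l⊆c → q₁⊑q₂ (av (_ , c∈ , l⊆c)))))

  opaque

    -- The supports of the rows come from `rows-affordable`. They sit at actual nodes because an
    -- `empty` support would mean a zero row, which `A≢0` excludes.
    cancellationFreeSize-upper : ∃ λ s → s ≤ q * 2 ^ k + n * q × CancellationFreeSize A s
    cancellationFreeSize-upper with rows-affordable
    ... | afford {s} s≤ p _ av = s , s≤ , toCircuit p outs , toCircuit-cancellationFree p outs ,
      toCircuit-computes p outs λ i j → begin
        j ∈ᵇ supp p (Vec.lookup outs i)                  ≡⟨ cong (λ u → j ∈ᵇ supp p u) (lookup∘tabulate (proj₁ ∘ nodeOf) i) ⟩
        j ∈ᵇ supp p (proj₁ (nodeOf i))                     ≡⟨ cong (j ∈ᵇ_) (proj₂ (nodeOf i)) ⟩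
        j ∈ᵇ support (Vec.lookup A i) (allFin n)         ≡⟨ ∈ᵇ-support-allFin (Vec.lookup A i) j ⟩
        Vec.lookup (Vec.lookup A i) j                    ∎
      where
      open ≡-Reasoning
      nodeOf : ∀ i → ∃ λ u → supp p u ≡ support (Vec.lookup A i) (allFin n)
      nodeOf i with support (Vec.lookup A i) (allFin n) in eq | av (i , refl)
      ... | l | node u eq′ = u , eq′
      ... | _ | empty      = contradiction (lookup-ext λ j → begin
        Vec.lookup (Vec.lookup A i) j            ≡⟨ ∈ᵇ-support-allFin (Vec.lookup A i) j ⟨
        j ∈ᵇ support (Vec.lookup A i) (allFin n) ≡⟨ cong (j ∈ᵇ_) eq ⟩
        false                                    ≡⟨ lookup-replicate j false ⟨
        Vec.lookup (Vec.replicate n false) j     ∎) (A≢0 i)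
      outs : Vec (Node n s) n
      outs = tabulate (proj₁ ∘ nodeOf)

-- Counting the exceptional matrices

least : {P : Pred ℕ 0ℓ} → Decidable P → ∀ {b} → P b → ∃ (IsLeast P)
-- `go` searches strictly below its argument, so `suc b` is what brings `b` itself into range.
least {P} P? {b} Pb with go (suc b)
  where
  go : ∀ b → ∃ (IsLeast P) ⊎ (∀ {k} → k < b → ¬ P k)
  go zero    = inj₂ λ ()
  go (suc b) with go b
  ... | inj₁ l = inj₁ l
  ... | inj₂ none with P? b
  ...   | yes Pb = inj₁ (b , Pb , λ k Pk → ℕ.≮⇒≥ λ k<b → none k<b Pk)
  ...   | no ¬Pb = inj₂ λ {k} k<1+b → case (ℕ.m≤n⇒m<n∨m≡n (ℕ.≤-pred k<1+b))
    where
    case : ∀ {k} → k < b ⊎ k ≡ b → ¬ P k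
    case (inj₁ k<b)  = none k<b
    case (inj₂ refl) = ¬Pb
... | inj₁ l    = l
... | inj₂ none = contradiction Pb (none ℕ.≤-refl)

isLeast-unique : {P : Pred ℕ 0ℓ} → ∀ {l m} → IsLeast P l → IsLeast P m → l ≡ m
isLeast-unique (Pl , l≤) (Pm , m≤) = ℕ.≤-antisym (l≤ _ Pm) (m≤ _ Pl)

cancellationFree⇒linear : (A : Matrix n) → CancellationFreeSize A s → LinearSize A s
cancellationFree⇒linear A (C , _ , h) = C , h

NonzeroRows : Matrix n → Set
NonzeroRows A = ∀ i → Vec.lookup A i ≢ Vec.replicate _ false

zeroRow? : (A : Matrix n) → Dec (∃ λ i → Vec.lookup A i ≡ Vec.replicate n false)
zeroRow? A = any? λ i → ≡-dec _≟ᵇ_ (Vec.lookup A i) (Vec.replicate _ false)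

least-sizes : {A : Matrix n} → CancellationFreeSize A s →
  ∃ (IsLeast (CancellationFreeSize A)) × ∃ (IsLeast (LinearSize A))
least-sizes {A = A} cf =
  least (cancellationFreeSize? A) cf , least (linearSize? A) (cancellationFree⇒linear A cf)

opaque

  -- A zero row refutes the predicate. Otherwise both least sizes exist and are unique, so comparing
  -- them decides it.
  cancellationRatio≤? : ∀ c → Decidable (CancellationRatio≤ c {n})
  cancellationRatio≤? {n} c A with zeroRow? A
  ... | yes (i , Aᵢ≡0) = no λ (s , t , (cf , _) , _) → zero-row⇒¬cancellationFreeSize A Aᵢ≡0 cf
  ... | no A≢0
    -- Any cancellation-free circuit will do to bound the two searches; blocks of a single input
    -- give one for every `n`.
    with cancellationFreeSize-upper {A = A} (λ i eq → A≢0 (i , eq)) {n} {1} (ℕ.≤-reflexive (sym (ℕ.*-identityʳ n)))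
  ... | _ , _ , cf with least-sizes {A = A} cf
  ... | (s , s-least) , (t , t-least) = map′
    (λ s≤ct → s , t , s-least , t-least , s≤ct)
    (λ (s′ , t′ , s′-least , t′-least , s′≤ct′) →
      subst (λ s → s ≤ c * t) (isLeast-unique s′-least s-least)
        (subst (λ t → s′ ≤ c * t) (isLeast-unique t′-least t-least) s′≤ct′))
    (s ℕ.≤? c * t)

-- The threshold `T` bounds the least linear size from below, while `s` bounds the least
-- cancellation-free size from above.
cancellationRatio≤-intro : ∀ {c T s} (A : Matrix n) → CancellationFreeSize A s →
  (∀ {t} → t < T → ¬ LinearSize A t) → (∀ {t} → T ≤ t → s ≤ c * t) → CancellationRatio≤ c A
cancellationRatio≤-intro A cf none s≤ with least-sizes {A = A} cf
... | (s′ , s′-least) , (t , t-least) = s′ , t , s′-least , t-least ,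
  ℕ.≤-trans (proj₂ s′-least _ cf) (s≤ (ℕ.≮⇒≥ λ t<T → none t<T (proj₁ t-least)))

-- Coding matrices as good, with a zero row, or computed by a small circuit

vectors-unique : {A : Set} {xs : List A} → Unique xs → ∀ n → Unique (vectors xs n)
vectors-unique xs-u zero    = [] ∷ []
vectors-unique xs-u (suc n) = cartesianProductWith⁺ _∷_ ∷-injective xs-u (vectors-unique xs-u n)

matrices : ∀ n → List (Matrix n)
matrices n = vectors (vectors bits n) n

∈-matrices : (A : Matrix n) → A ∈ matrices n
∈-matrices = ∈-vectors (∈-vectors ∈-bits)

matrices-unique : ∀ n → Unique (matrices n)
matrices-unique n = vectors-unique (vectors-unique (((λ ()) ∷ []) ∷ ([] ∷ [])) n) n

length-matrices : ∀ n → length (matrices n) ≡ (2 ^ n) ^ n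
length-matrices n = trans (length-vectors n) (cong (_^ n) (length-vectors n))

lookup-injective : {A : Set} {xs : List A} → Unique xs → ∀ {i j} → List.lookup xs i ≡ List.lookup xs j → i ≡ j
lookup-injective (h ∷ u) {zero}  {zero}  _  = refl
lookup-injective (h ∷ u) {zero}  {suc j} eq = contradiction eq (All.lookup h (∈-lookup j))
lookup-injective (h ∷ u) {suc i} {zero}  eq = contradiction (sym eq) (All.lookup h (∈-lookup i))
lookup-injective (h ∷ u) {suc i} {suc j} eq = cong suc (lookup-injective u eq)

-- The position of its code injects `xs` into the positions of `ys`. A relation replaces a decoding
-- function because some codes, such as cyclic gate lists, decode to nothing.
encoding⇒length≤ : {A B : Set} (R : A → B → Set) → (∀ {x y z} → R x z → R y z → x ≡ y) →
  ∀ {xs ys} → Unique xs → (∀ x → ∃ λ y → y ∈ ys × R x y) → length xs ≤ length ys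
encoding⇒length≤ R R-inj {xs} {ys} xs-u code = injective⇒≤ {f = position ∘ List.lookup xs}
  λ {i} {j} eq → lookup-injective xs-u (R-inj (encoded (List.lookup xs i))
    (subst (λ p → R (List.lookup xs j) (List.lookup ys p)) (sym eq) (encoded (List.lookup xs j))))
  where
  position = λ x → index (proj₁ (proj₂ (code x)))
  encoded : ∀ x → R x (List.lookup ys (position x))
  encoded x with code x
  ... | y , y∈ , Rxy = subst (R x) (lookup-index y∈) Rxy

length-concatMap-≤ : {A B : Set} (f : A → List B) {b : ℕ} (xs : List A) →
  (∀ {x} → x ∈ xs → length (f x) ≤ b) → length (concatMap f xs) ≤ length xs * b
length-concatMap-≤ f []       h = z≤n
length-concatMap-≤ f (x ∷ xs) h = subst (_≤ _) (sym (length-++ (f x)))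
  (ℕ.+-mono-≤ (h (here refl)) (length-concatMap-≤ f xs (h ∘ there)))

goodMatrices : ∀ c n → List (Matrix n)
goodMatrices c n = filter (cancellationRatio≤? c) (matrices n)

∈-goodMatrices : ∀ c (A : Matrix n) → A ∈ goodMatrices c n ⇔ CancellationRatio≤ c A
∈-goodMatrices {n} c A = mk⇔ (proj₂ ∘ ∈-filter⁻ (cancellationRatio≤? c) {xs = matrices n})
  (∈-filter⁺ (cancellationRatio≤? c) (∈-matrices A))

goodMatrices-unique : ∀ c n → Unique (goodMatrices c n)
goodMatrices-unique c n = filter⁺ (cancellationRatio≤? c) (matrices-unique n)

module _ (c m T s₀ : ℕ)
  (upper : (A : Matrix (suc m)) → NonzeroRows A → ∃ λ s → s ≤ s₀ × CancellationFreeSize A s)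
  (T≤⇒ : ∀ {t} → T ≤ t → s₀ ≤ c * t)
  where

  private
    N = suc m

  -- A zero row is coded by its position and the other `m` rows, which saves a factor `2 ^ N` over
  -- writing out the matrix.
  data Code : Set where
    good    : Matrix N → Code
    zeroRow : Fin N → Vec (𝔽₂^ N) m → Code
    circuit : ∀ t → RawCircuit N t → Code

  Encodes : Matrix N → Code → Set
  Encodes A (good B)      = A ≡ B
  Encodes A (zeroRow i B) = A ≡ insertAt B i (Vec.replicate N false)
  Encodes A (circuit t r) = ∃ λ (C : Circuit N t) → raw C ≡ r × Computes C A

  encodes-injective : ∀ {A B z} → Encodes A z → Encodes B z → A ≡ B
  encodes-injective {z = good _}      refl             refl             = refl
  encodes-injective {z = zeroRow _ _} refl             refl             = refl
  encodes-injective {z = circuit _ _} (C , eq , hA) (D , eq′ , hB) =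
    computes-unique C hA (computes-raw D C (trans eq′ (sym eq)) hB)

  circuitCodes : ℕ → List Code
  circuitCodes t = List.map (circuit t) (rawCircuits N t)

  codes : List Code
  codes = List.map good (goodMatrices c N)
    ++ cartesianProductWith zeroRow (allFin N) (vectors (vectors bits N) m)
    ++ concatMap circuitCodes (upTo T)

  -- With no zero row and no linear circuit below `T` gates, `upper` and `cancellationRatio≤-intro`
  -- place `A` among the good matrices.
  encode : (A : Matrix N) → ∃ λ z → z ∈ codes × Encodes A z
  encode A with zeroRow? A
  ... | yes (i , Aᵢ≡0) = zeroRow i (removeAt A i) ,
    ∈-++⁺ʳ (List.map good (goodMatrices c N))
      (∈-++⁺ˡ (∈-cartesianProductWith⁺ zeroRow (∈-allFin i) (∈-vectors (∈-vectors ∈-bits) _))) ,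
    trans (sym (insertAt-removeAt A i)) (cong (insertAt (removeAt A i) i) Aᵢ≡0)
  ... | no A≢0 with ℕ.anyUpTo? (linearSize? A) T
  ...   | yes (t , t<T , C , h) = circuit t (raw C) ,
    ∈-++⁺ʳ (List.map good (goodMatrices c N))
      (∈-++⁺ʳ (cartesianProductWith zeroRow (allFin N) (vectors (vectors bits N) m))
        (∈-concatMap⁺ circuitCodes (lose (∈-upTo⁺ t<T) (∈-map⁺ (circuit t) (∈-rawCircuits (raw C)))))) ,
    C , refl , h
  ...   | no none with upper A (λ i eq → A≢0 (i , eq))
  ...     | s , s≤s₀ , cf = good A ,
    ∈-++⁺ˡ (∈-map⁺ good (∈-filter⁺ (cancellationRatio≤? c) (∈-matrices A)
      (cancellationRatio≤-intro {c = c} A cf (λ t<T h → none (_ , t<T , h))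
        (λ T≤t → ℕ.≤-trans s≤s₀ (T≤⇒ T≤t))))) ,
    refl

  -- Zero-row codes number `N * (2 ^ N) ^ m`; circuits contribute at most `b` codes for each of the
  -- `T` sizes below `T`.
  matrices≤good+exceptions : ∀ {b} → (∀ {t} → t < T → length (rawCircuits N t) ≤ b) →
    (2 ^ N) ^ N ≤ length (goodMatrices c N) + (N * (2 ^ N) ^ m + T * b)
  matrices≤good+exceptions {b} b-bound = begin
    (2 ^ N) ^ N
      ≡⟨ length-matrices N ⟨
    length (matrices N)
      ≤⟨ encoding⇒length≤ Encodes (λ {x} {y} {z} → encodes-injective {x} {y} {z}) (matrices-unique N) encode ⟩
    length codes
      ≡⟨ trans (length-++ goods) (cong (length goods +_) (length-++ zeros)) ⟩
    length goods + (length zeros + length (concatMap circuitCodes (upTo T)))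
      ≤⟨ ℕ.+-mono-≤ (ℕ.≤-reflexive (length-map good (goodMatrices c N)))
           (ℕ.+-mono-≤ (ℕ.≤-reflexive zeros-length) circuits-length) ⟩
    length (goodMatrices c N) + (N * (2 ^ N) ^ m + T * b) ∎
    where
    open ℕ.≤-Reasoning
    goods = List.map good (goodMatrices c N)
    zeros = cartesianProductWith zeroRow (allFin N) (vectors (vectors bits N) m)
    zeros-length : length zeros ≡ N * (2 ^ N) ^ m
    zeros-length = trans (length-cartesianProductWith zeroRow (allFin N) (vectors (vectors bits N) m))
      (cong₂ _*_ (length-tabulate {n = N} id) (trans (length-vectors m) (cong (_^ m) (length-vectors N))))
    circuits-length : length (concatMap circuitCodes (upTo T)) ≤ T * b
    circuits-length = ℕ.≤-trans
      (length-concatMap-≤ circuitCodes (upTo T) λ {t} t∈ →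
        ℕ.≤-trans (ℕ.≤-reflexive (length-map (circuit t) (rawCircuits N t))) (b-bound (∈-upTo⁻ t∈)))
      (ℕ.≤-reflexive (cong (_* b) (length-upTo T)))

-- Numerical estimates

m<[1+m/n]*n : ∀ m n .{{_ : NonZero n}} → m < suc (m / n) * n
m<[1+m/n]*n m n = begin-strict
  m                    ≡⟨ m≡m%n+[m/n]*n m n ⟩
  m % n + m / n * n    <⟨ ℕ.+-monoˡ-< (m / n * n) (m%n<n m n) ⟩
  n + m / n * n        ∎
  where open ℕ.≤-Reasoning

-- The floor of the binary logarithm of `suc n`, which becomes the block length.
binary-magnitude : ∀ n → ∃ λ k → 2 ^ k ≤ suc n × suc n < 2 ^ suc k
binary-magnitude zero = 0 , s≤s z≤n , s≤s (s≤s z≤n)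
binary-magnitude (suc n) with binary-magnitude n
... | k , k≤ , <k with ℕ.m≤n⇒m<n∨m≡n <k
...   | inj₁ 2+n< = k , ℕ.m≤n⇒m≤1+n k≤ , 2+n<
...   | inj₂ 2+n≡ = suc k , ℕ.≤-reflexive (sym 2+n≡) ,
  subst (_< 2 ^ suc (suc k)) (sym 2+n≡) (ℕ.^-monoʳ-< 2 (s≤s (s≤s z≤n)) (ℕ.n<1+n (suc k)))

-- Fails at 5, where 40 exceeds 32. Each step adds 8 on the left and doubles the right.
8k≤2^k : ∀ j → 8 * (6 + j) ≤ 2 ^ (6 + j)
8k≤2^k zero    = ℕ.m≤m+n 48 16
8k≤2^k (suc j) = begin
  8 * (6 + suc j)             ≡⟨ lhs j ⟩
  8 * (6 + j) + 8             ≤⟨ ℕ.+-mono-≤ (8k≤2^k j) (ℕ.≤-trans (ℕ.^-monoʳ-≤ 2 {3} {6 + j} (s≤s (s≤s (s≤s z≤n)))) (ℕ.≤-reflexive (sym (ℕ.+-identityʳ _)))) ⟩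
  2 ^ (6 + suc j)             ∎
  where
  open ℕ.≤-Reasoning
  lhs : ∀ j → 8 * (6 + suc j) ≡ 8 * (6 + j) + 8
  lhs = solve-∀

-- Fails at 4, where 20 exceeds 16. A step adds twice `suc n`, at most `suc n * n`, and so at most
-- doubles the left side.
[1+n]*n<2^n : ∀ j → suc (5 + j) * (5 + j) < 2 ^ (5 + j)
[1+n]*n<2^n zero    = ℕ.m≤m+n 31 1
[1+n]*n<2^n (suc j) = begin-strict
  suc (5 + suc j) * (5 + suc j)                 ≡⟨ lhs j ⟩
  suc (5 + j) * (5 + j) + 2 * suc (5 + j)       <⟨ ℕ.+-mono-<-≤ ([1+n]*n<2^n j) (ℕ.≤-trans
                                                     (ℕ.≤-trans (ℕ.*-monoˡ-≤ (suc (5 + j)) {2} {5 + j} (s≤s (s≤s z≤n)))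
                                                       (ℕ.≤-reflexive (ℕ.*-comm (5 + j) (suc (5 + j)))))
                                                     (ℕ.<⇒≤ ([1+n]*n<2^n j))) ⟩
  2 ^ (5 + j) + 2 ^ (5 + j)                     ≡⟨ cong (2 ^ (5 + j) +_) (ℕ.+-identityʳ _) ⟨
  2 ^ (5 + suc j)                               ∎
  where
  open ℕ.≤-Reasoning
  lhs : ∀ j → suc (5 + suc j) * (5 + suc j) ≡ suc (5 + j) * (5 + j) + 2 * suc (5 + j)
  lhs = solve-∀

module Parameters {n k : ℕ} .{{_ : NonZero k}} (6≤k : 6 ≤ k) (2^k≤n : 2 ^ k ≤ n) (n<2^1+k : n < 2 ^ suc k) where

  open ℕ.≤-Reasoning

  -- With q blocks of k inputs, 2nq gates suffice for nonzero rows, and almost no matrix has a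
  -- linear circuit with at most r gates; so the ratio is at most 2 · 24.
  q r : ℕ
  q = suc (n / k)
  r = n * q / 24

  8k≤n : 8 * k ≤ n
  8k≤n = ℕ.≤-trans (subst (λ k → 8 * k ≤ 2 ^ k) (ℕ.m+[n∸m]≡n 6≤k) (8k≤2^k _)) 2^k≤n

  k≤n : k ≤ n
  k≤n = ℕ.≤-trans (ℕ.m≤m+n k _) 8k≤n

  6≤n : 6 ≤ n
  6≤n = ℕ.≤-trans 6≤k k≤n

  n≤qk : n ≤ q * k
  n≤qk = ℕ.<⇒≤ (m<[1+m/n]*n n k)

  qk≤2n : q * k ≤ 2 * n
  qk≤2n = begin
    k + n / k * k ≤⟨ ℕ.+-mono-≤ k≤n (m/n*n≤m n k) ⟩
    n + n         ≡⟨ cong (n +_) (ℕ.+-identityʳ n) ⟨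
    2 * n         ∎

  q≤n : q ≤ n
  q≤n = ℕ.*-cancelʳ-≤ q n 2 (begin
    q * 2 ≤⟨ ℕ.*-monoʳ-≤ q (ℕ.≤-trans (s≤s (s≤s z≤n)) 6≤k) ⟩
    q * k ≤⟨ qk≤2n ⟩
    2 * n ≡⟨ ℕ.*-comm 2 n ⟩
    n * 2 ∎)

  -- The divisor 24 in `r` is made for this: `6 * (k * r)`, the main term of `exponent-bound`, takes
  -- up at most half of `n * n`.
  12kr≤n² : 12 * (k * r) ≤ n * n
  12kr≤n² = ℕ.*-cancelˡ-≤ 2 (begin
    2 * (12 * (k * r)) ≡⟨ e₁ k r ⟩
    r * 24 * k         ≤⟨ ℕ.*-monoˡ-≤ k (m/n*n≤m (n * q) 24) ⟩
    n * q * k          ≡⟨ ℕ.*-assoc n q k ⟩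
    n * (q * k)        ≤⟨ ℕ.*-monoʳ-≤ n qk≤2n ⟩
    n * (2 * n)        ≡⟨ e₂ n ⟩
    2 * (n * n)        ∎)
    where
    e₁ : ∀ k r → 2 * (12 * (k * r)) ≡ r * 24 * k
    e₁ = solve-∀
    e₂ : ∀ n → n * (2 * n) ≡ 2 * (n * n)
    e₂ = solve-∀

  -- After doubling, `12 * (k * r)` fills one copy of `n * n`. The other terms sum to at most
  -- `8 * k * n`, which fits into the second copy by `8k≤n`.
  exponent-bound : 3 * k * suc (2 * r + n) + n ≤ n * n
  exponent-bound = ℕ.*-cancelˡ-≤ 2 (begin
    2 * (3 * k * suc (2 * r + n) + n)                ≡⟨ e₁ n k r ⟩
    12 * (k * r) + (6 * (k * n) + 6 * k + 2 * n)     ≤⟨ ℕ.+-mono-≤ 12kr≤n² (ℕ.+-mono-≤ (ℕ.+-monoʳ-≤ (6 * (k * n))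
                                                          (ℕ.≤-trans (ℕ.*-monoˡ-≤ k 6≤n) (ℕ.≤-reflexive (ℕ.*-comm n k))))
                                                          (ℕ.*-monoˡ-≤ n (ℕ.≤-trans (s≤s (s≤s z≤n)) 6≤k))) ⟩
    n * n + (6 * (k * n) + k * n + k * n)            ≡⟨ e₂ n k ⟩
    n * n + 8 * k * n                                ≤⟨ ℕ.+-monoʳ-≤ (n * n) (ℕ.*-monoˡ-≤ n 8k≤n) ⟩
    n * n + n * n                                    ≡⟨ cong (n * n +_) (ℕ.+-identityʳ (n * n)) ⟨
    2 * (n * n)                                      ∎)
    where
    e₁ : ∀ n k r → 2 * (3 * k * suc (2 * r + n) + n) ≡ 12 * (k * r) + (6 * (k * n) + 6 * k + 2 * n)
    e₁ = solve-∀
    e₂ : ∀ n k → n * n + (6 * (k * n) + k * n + k * n) ≡ n * n + 8 * k * n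
    e₂ = solve-∀

  -- So `3 * k` bits suffice to name a node. The bound passes through twice the square of `n`, and
  -- the surplus factor 8 is absorbed by `3 ≤ k`.
  n+r≤2^3k : n + r ≤ 2 ^ (3 * k)
  n+r≤2^3k = begin
    n + r                          ≤⟨ ℕ.+-mono-≤ (subst (_≤ n * n) (ℕ.*-identityʳ n) (ℕ.*-monoʳ-≤ n (ℕ.≤-trans (s≤s z≤n) 6≤n)))
                                        (ℕ.≤-trans (ℕ.≤-trans (ℕ.m≤m*n r 24) (m/n*n≤m (n * q) 24)) (ℕ.*-monoʳ-≤ n q≤n)) ⟩
    n * n + n * n                  ≡⟨ cong (n * n +_) (ℕ.+-identityʳ (n * n)) ⟨
    2 * (n * n)                    ≤⟨ ℕ.*-monoʳ-≤ 2 (ℕ.*-mono-≤ (ℕ.<⇒≤ n<2^1+k) (ℕ.<⇒≤ n<2^1+k)) ⟩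
    2 * (2 ^ suc k * 2 ^ suc k)    ≡⟨ cong (2 *_) (ℕ.^-distribˡ-+-* 2 (suc k) (suc k)) ⟨
    2 ^ suc (suc k + suc k)        ≤⟨ ℕ.^-monoʳ-≤ 2 (begin
      suc (suc k + suc k) ≡⟨ e k ⟩
      3 + 2 * k           ≤⟨ ℕ.+-monoˡ-≤ (2 * k) (ℕ.≤-trans (s≤s (s≤s (s≤s z≤n))) 6≤k) ⟩
      k + 2 * k           ∎) ⟩
    2 ^ (3 * k)                    ∎
    where
    e : ∀ k → suc (suc k + suc k) ≡ 3 + 2 * k
    e = solve-∀

  -- Two node names per gate and one per output, each among at most `2 ^ (3 * k)`.
  circuit-count-bound : ∀ {t} → t < suc r →
    ((n + t) * (n + t)) ^ t * (n + t) ^ n ≤ (2 ^ (3 * k)) ^ (2 * r + n)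
  circuit-count-bound {t} (s≤s t≤r) = begin
    ((n + t) * (n + t)) ^ t * (n + t) ^ n  ≤⟨ ℕ.*-mono-≤ (ℕ.^-monoˡ-≤ t (ℕ.*-mono-≤ n+t≤M n+t≤M)) (ℕ.^-monoˡ-≤ n n+t≤M) ⟩
    (M * M) ^ t * M ^ n                    ≡⟨ cong (λ x → x ^ t * M ^ n) (cong (M *_) (ℕ.*-identityʳ M)) ⟨
    (M ^ 2) ^ t * M ^ n                    ≡⟨ cong (_* M ^ n) (ℕ.^-*-assoc M 2 t) ⟩
    M ^ (2 * t) * M ^ n                    ≡⟨ ℕ.^-distribˡ-+-* M (2 * t) n ⟨
    M ^ (2 * t + n)                        ≤⟨ ℕ.^-monoʳ-≤ M (ℕ.+-monoˡ-≤ n (ℕ.*-monoʳ-≤ 2 t≤r)) ⟩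
    M ^ (2 * r + n)                        ∎
    where
    M = 2 ^ (3 * k)
    instance _ = ℕ.m^n≢0 2 (3 * k)
    n+t≤M = ℕ.≤-trans (ℕ.+-monoʳ-≤ n t≤r) n+r≤2^3k

  -- The target is a fraction `1 / 2 ^ n` of all matrices.
  all-circuits-bound : ∀ {m} → n ≡ suc m → suc r * (2 ^ (3 * k)) ^ (2 * r + n) ≤ (2 ^ n) ^ m
  all-circuits-bound {m} n≡1+m = begin
    -- Summing over the `suc r` sizes costs one further factor `M`, hence the `suc` in
    -- `exponent-bound`.
    suc r * M ^ (2 * r + n)       ≤⟨ ℕ.*-monoˡ-≤ (M ^ (2 * r + n)) (ℕ.≤-trans (ℕ.+-monoˡ-≤ r (ℕ.≤-trans (s≤s z≤n) 6≤n)) n+r≤2^3k) ⟩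
    M ^ suc (2 * r + n)           ≡⟨ ℕ.^-*-assoc 2 (3 * k) (suc (2 * r + n)) ⟩
    2 ^ (3 * k * suc (2 * r + n)) ≤⟨ ℕ.^-monoʳ-≤ 2 (ℕ.+-cancelʳ-≤ n _ (n * m) (begin
      3 * k * suc (2 * r + n) + n ≤⟨ exponent-bound ⟩
      n * n                       ≡⟨ cong (n *_) n≡1+m ⟩
      n * suc m                   ≡⟨ ℕ.*-suc n m ⟩
      n + n * m                   ≡⟨ ℕ.+-comm n (n * m) ⟩
      n * m + n                   ∎)) ⟩
    2 ^ (n * m)                   ≡⟨ ℕ.^-*-assoc 2 n m ⟨
    (2 ^ n) ^ m                   ∎
    where M = 2 ^ (3 * k)

  size-ratio : ∀ {t} → suc r ≤ t → q * 2 ^ k + n * q ≤ 48 * t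
  size-ratio {t} r<t = begin
    q * 2 ^ k + n * q   ≤⟨ ℕ.+-monoˡ-≤ (n * q) (ℕ.*-monoʳ-≤ q 2^k≤n) ⟩
    q * n + n * q       ≡⟨ e₁ n q ⟩
    -- Rounding down in `r` does no harm, because `t` is at least `suc r`.
    2 * (n * q)         ≤⟨ ℕ.*-monoʳ-≤ 2 (ℕ.<⇒≤ (m<[1+m/n]*n (n * q) 24)) ⟩
    2 * (suc r * 24)    ≤⟨ ℕ.*-monoʳ-≤ 2 (ℕ.*-monoˡ-≤ 24 r<t) ⟩
    2 * (t * 24)        ≡⟨ e₂ t ⟩
    48 * t              ∎
    where
    e₁ : ∀ n q → q * n + n * q ≡ 2 * (n * q)
    e₁ = solve-∀
    e₂ : ∀ t → 2 * (t * 24) ≡ 48 * t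
    e₂ = solve-∀

-- The limit

-- The left side is the numerator of a fraction minus 1 as unnormalised rationals produce it.
∣m-n∣≡n∸m : ∀ {m n} → m ≤ n → ℤ.∣ ℤ.+ m ℤ.* ℤ.+ 1 ℤ.+ -[1+ 0 ] ℤ.* ℤ.+ n ∣ ≡ n ∸ m
∣m-n∣≡n∸m {m} {n} m≤n = begin
  ℤ.∣ ℤ.+ m ℤ.* ℤ.+ 1 ℤ.+ -[1+ 0 ] ℤ.* ℤ.+ n ∣ ≡⟨ cong ℤ.∣_∣ (cong₂ ℤ._+_ (ℤ.*-identityʳ (ℤ.+ m)) (ℤ.-1*i≡-i (ℤ.+ n))) ⟩
  ℤ.∣ ℤ.+ m ℤ.- ℤ.+ n ∣                       ≡⟨ cong ℤ.∣_∣ (trans (ℤ.m-n≡m⊖n m n) (ℤ.⊖-≤ m≤n)) ⟩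
  ℤ.∣ ℤ.- (ℤ.+ (n ∸ m)) ∣                   ≡⟨ ℤ.∣-i∣≡∣i∣ (ℤ.+ (n ∸ m)) ⟩
  n ∸ m                                   ∎
  where open ≡-Reasoning

-- A positive `ε` is at least one over its denominator, so it suffices that `(D ∸ g) / D` lie below
-- that.
fraction-near-1 : ∀ g D .{{_ : NonZero D}} (ε : ℚ) → 0ℚ ℚ.< ε →
  g ≤ D → (D ∸ g) * ℚ.denominatorℕ ε < D → ℚ.∣ (ℤ.+ g ℚ./ D) ℚ.- 1ℚ ∣ ℚ.< ε
fraction-near-1 g D@(suc D-1) ε@(mkℚ (ℤ.+ suc p) d _) _ g≤D gap = toℚᵘ-cancel-<
  (ℚᵘ.<-respˡ-≃ (ℚᵘ.≃-sym unnormalised) (*<* (subst₂ ℤ._<_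
    (ℤ.pos-* numerator (suc d)) (ℤ.pos-* (suc p) (D * 1)) (+<+ bound))))
  where
  open ℕ.≤-Reasoning
  x = ℤ.+ g ℚ./ D
  unnormalised : ℚ.toℚᵘ ℚ.∣ x ℚ.- 1ℚ ∣ ℚᵘ.≃ ℚᵘ.∣ mkℚᵘ (ℤ.+ g) D-1 ℚᵘ.+ mkℚᵘ -[1+ 0 ] 0 ∣
  unnormalised = ℚᵘ.≃-trans (toℚᵘ-homo-∣-∣ (x ℚ.- 1ℚ)) (ℚᵘ.∣-∣-cong
    (ℚᵘ.≃-trans (toℚᵘ-homo-+ x (ℚ.- 1ℚ)) (ℚᵘ.+-congˡ (mkℚᵘ -[1+ 0 ] 0) (toℚᵘ-fromℚᵘ (mkℚᵘ (ℤ.+ g) D-1)))))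
  numerator = ℤ.∣ ℤ.+ g ℤ.* ℤ.+ 1 ℤ.+ -[1+ 0 ] ℤ.* ℤ.+ D ∣
  bound : numerator * suc d < suc p * (D * 1)
  bound = begin-strict
    numerator * suc d ≡⟨ cong (_* suc d) (∣m-n∣≡n∸m g≤D) ⟩
    (D ∸ g) * suc d   <⟨ gap ⟩
    D                 ≡⟨ ℕ.*-identityʳ D ⟨
    D * 1             ≤⟨ ℕ.m≤n*m (D * 1) (suc p) ⟩
    suc p * (D * 1)   ∎
fraction-near-1 g D (mkℚ (ℤ.+ zero) _ _) (ℚ.*<* (+<+ ()))
fraction-near-1 g D (mkℚ -[1+ _ ] _ _) (ℚ.*<* ())

goodFraction : ℕ → ℕ → ℚ
goodFraction c n = ℚ._/_ (ℤ.+ length (goodMatrices c n)) (2 ^ (n * n)) {{ℕ.m^n≢0 2 (n * n)}}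

goodFraction-isFraction : ∀ c n → IsFraction {n} (CancellationRatio≤ c) (goodFraction c n)
goodFraction-isFraction c n = goodMatrices c n , goodMatrices-unique c n , ∈-goodMatrices c , refl

goodMatrices≤ : ∀ c n → length (goodMatrices c n) ≤ 2 ^ (n * n)
goodMatrices≤ c n = ℕ.≤-trans (length-filter (cancellationRatio≤? c) (matrices n))
  (ℕ.≤-reflexive (trans (length-matrices n) (ℕ.^-*-assoc 2 n n)))

-- The factor `suc (suc m)` is `suc m` for the zero rows plus one for the small circuits.
exceptions-bound : ∀ m → 64 ≤ suc m →
  (2 ^ suc m) ^ suc m ≤ length (goodMatrices 48 (suc m)) + suc (suc m) * (2 ^ suc m) ^ m
exceptions-bound m 64≤n with binary-magnitude m
-- The case `k = 0` is split off so that `Parameters` can divide by `k`.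
... | zero , _ , n<2 = contradiction (ℕ.<-≤-trans n<2 (ℕ.≤-trans (ℕ.m≤m+n 2 62) 64≤n)) (ℕ.<-irrefl refl)
... | k@(suc _) , 2^k≤n , n<2^1+k = begin
  (2 ^ N) ^ N
    ≤⟨ matrices≤good+exceptions 48 m (suc r) (q * 2 ^ k + N * q)
         (λ A A≢0 → cancellationFreeSize-upper {A = A} A≢0 {q} {k} n≤qk) size-ratio
         (λ {t} t<T → ℕ.≤-trans (ℕ.≤-reflexive (length-rawCircuits N t)) (circuit-count-bound t<T)) ⟩
  length (goodMatrices 48 N) + (N * (2 ^ N) ^ m + suc r * (2 ^ (3 * k)) ^ (2 * r + N))
    ≤⟨ ℕ.+-monoʳ-≤ (length (goodMatrices 48 N)) (ℕ.+-monoʳ-≤ (N * (2 ^ N) ^ m) (all-circuits-bound refl)) ⟩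
  length (goodMatrices 48 N) + (N * (2 ^ N) ^ m + (2 ^ N) ^ m)
    ≡⟨ cong (λ x → length (goodMatrices 48 N) + x) (ℕ.+-comm (N * (2 ^ N) ^ m) _) ⟩
  length (goodMatrices 48 N) + suc N * (2 ^ N) ^ m ∎
  where
  open ℕ.≤-Reasoning
  N = suc m
  6≤k : 6 ≤ k
  -- As 64 is `2 ^ 6`, `k < 6` would give `N < 2 ^ suc k ≤ 64`.
  6≤k = ℕ.≮⇒≥ λ k<6 → ℕ.<-irrefl refl
    (ℕ.<-≤-trans n<2^1+k (ℕ.≤-trans (ℕ.^-monoʳ-≤ 2 k<6) 64≤n))
  open Parameters {N} {k} 6≤k 2^k≤n n<2^1+k

goodFraction-convergesTo-1 : goodFraction 48 ConvergesTo 1ℚ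
-- The sum meets two demands at once: 64 for `exceptions-bound`, and `d` so that `N` dominates the
-- denominator of `ε`.
goodFraction-convergesTo-1 ε 0<ε = 64 + d , λ
  { zero    ()
  ; (suc m) N≤n → near m (ℕ.m+n≤o⇒m≤o 64 N≤n) (ℕ.m+n≤o⇒n≤o 64 N≤n)
  }
  where
  d = ℚ.denominatorℕ ε
  near : ∀ m → 64 ≤ suc m → d ≤ suc m → ℚ.∣ goodFraction 48 (suc m) ℚ.- 1ℚ ∣ ℚ.< ε
  near m 64≤n d≤n = fraction-near-1 g (2 ^ (N * N)) {{ℕ.m^n≢0 2 (N * N)}} ε 0<ε (goodMatrices≤ 48 N) (begin-strict
    (2 ^ (N * N) ∸ g) * d      ≤⟨ ℕ.*-monoˡ-≤ d (ℕ.m≤n+o⇒m∸n≤o (2 ^ (N * N)) g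
                                    (subst (_≤ g + suc N * (2 ^ N) ^ m) (ℕ.^-*-assoc 2 N N) (exceptions-bound m 64≤n))) ⟩
    suc N * (2 ^ N) ^ m * d    ≡⟨ e (suc N) ((2 ^ N) ^ m) d ⟩
    suc N * d * (2 ^ N) ^ m    ≤⟨ ℕ.*-monoˡ-≤ ((2 ^ N) ^ m) (ℕ.*-monoʳ-≤ (suc N) d≤n) ⟩
    -- Here the exceptional fraction, at most `suc N` over `2 ^ N`, is seen to stay below `1 / d`
    -- for every `d ≤ N`.
    suc N * N * (2 ^ N) ^ m    <⟨ ℕ.*-monoˡ-< ((2 ^ N) ^ m) {{ℕ.m^n≢0 (2 ^ N) m {{ℕ.m^n≢0 2 N}}}}
                                    (subst (λ n → suc n * n < 2 ^ n) (ℕ.m+[n∸m]≡n (ℕ.≤-trans (ℕ.m≤m+n 5 59) 64≤n)) ([1+n]*n<2^n (N ∸ 5))) ⟩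
    2 ^ N * (2 ^ N) ^ m        ≡⟨ ℕ.^-*-assoc 2 N N ⟩
    2 ^ (N * N)                ∎)
    where
    open ℕ.≤-Reasoning
    N = suc m
    g = length (goodMatrices 48 N)
    e : ∀ a b c → a * b * c ≡ a * c * b
    e = solve-∀

theorem3 : ∃ λ (c : ℕ) → ∃ λ (f : ℕ → ℚ) →
    (∀ n → IsFraction {n} (CancellationRatio≤ c) (f n)) × f ConvergesTo 1ℚ
theorem3 = 48 , goodFraction 48 , goodFraction-isFraction 48 , goodFraction-convergesTo-1
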